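{- Let $G = G_{n,1/2}$ be the binomial random graph on vertex set $[n]=\{1,\dots,n\}$ in which each pair is an edge independently with probability $1/2$. For a positive integer $k$ let $f(k)=\binom{n}{k}2^{ -\binom{k}{2}}$ (the expected number of $k$-cliques in $G$) and let $k_0=k_0(n)=\min\{k : f(k)<1\}$. Let $\nu_k(G)$ denote the maximum number of pairwise edge-disjoint $k$-cliques in $G$. Then for each fixed integer $C$ there is a constant $D$ such that, for all sufficiently large $n$, if $k=k_0-C$ then \[ \Pr\bigl(\nu_k(G) > Dn^2/k^3\bigr) < \exp[-n^2/k^2]. \]
   Context: Two cliques are edge-disjoint if they share no edge (they may share at most one vertex). $\log$ denotes the natural logarithm. -}

module Defs where

open import Data.Nat using (ℕ; zero; suc; _+_; _*_; _^_; _≤_; _<_; NonZero)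
open import Data.Nat.Properties using (m^n≢0)
open import Data.Nat.Combinatorics using (_C_)
open import Data.Integer using (ℤ; +_)
open import Data.Rational using (ℚ; 0ℚ; 1ℚ; _/_) renaming (_+_ to _+ℚ_; _*_ to _*ℚ_; _≤_ to _≤ℚ_; _<_ to _<ℚ_)
open import Data.Bool using (Bool; T)
open import Data.Fin using (Fin; toℕ)
open import Data.Fin.Subset using (Subset; _∈_; ∣_∣)
open import Data.Vec using (Vec; lookup)
open import Data.List using (List; length)
import Data.List.Membership.Propositional as LM
open import Data.Product using (Σ; ∃; _×_)
open import Data.Sum using (_⊎_)
open import Relation.Binary.PropositionalEquality using (_≡_; _≢_)
open import Relation.Nullary using (¬_)
open import Data.Empty using (⊥)

-- Graphs on [n] (vertex set Fin n).
-- A graph is encoded by an n×n Boolean table g; only the strict upper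
-- triangle is read: for i < j, {i,j} is an edge iff g[i][j] = true.
-- The uniform distribution on all 2^(n·n) tables pushes forward to
-- G(n,1/2) (each of the (n choose 2) upper-triangle entries is an
-- independent fair bit), so probabilities are counts / 2^(n·n).

Table : ℕ → Set
Table n = Vec (Vec Bool n) n

Adj : ∀ {n} → Table n → Fin n → Fin n → Set
Adj g i j = (toℕ i < toℕ j × T (lookup (lookup g i) j))
          ⊎ (toℕ j < toℕ i × T (lookup (lookup g j) i))

IsClique : ∀ {n} → Table n → ℕ → Subset n → Set
IsClique {n} g k S = ∣ S ∣ ≡ k × (∀ (u v : Fin n) → u ≢ v → u ∈ S → v ∈ S → Adj g u v)

EdgeDisjoint : ∀ {n} → Subset n → Subset n → Set
EdgeDisjoint {n} S T′ = ∀ (u v : Fin n) → u ≢ v → u ∈ S → v ∈ S → u ∈ T′ → v ∈ T′ → ⊥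

HasDisjointCliques : ∀ {n} → Table n → ℕ → ℕ → Set
HasDisjointCliques {n} g k m =
  Σ (Fin m → Subset n) λ F →
    (∀ i → IsClique g k (F i)) ×
    (∀ i j → i ≢ j → (F i ≢ F j) × EdgeDisjoint (F i) (F j))

-- ν_k(g) > D n² / k³ , cleared of denominators (k > 0):
-- some family of m pairwise edge-disjoint k-cliques has m · k³ > D · n².
NuGt : ∀ {n} → Table n → (k D : ℕ) → Set
NuGt {n} g k D = ∃ λ m → (D * (n * n) < m * (k ^ 3)) × HasDisjointCliques g k m

-- f(k) < 1  ⇔  (n choose k) < 2^(k choose 2);  k0 = least positive such k.

fLt1 : ℕ → ℕ → Set
fLt1 n k = n C k < 2 ^ (k C 2)

IsK0 : ℕ → ℕ → Set
IsK0 n k0 = (1 ≤ k0) × fLt1 n k0 × (∀ k → 1 ≤ k → k < k0 → ¬ fLt1 n k)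

expTerm : ℚ → ℕ → ℚ
expTerm x zero    = 1ℚ
expTerm x (suc i) = (expTerm x i *ℚ x) *ℚ (+ 1 / suc i)

expPartial : ℚ → ℕ → ℚ
expPartial x zero    = 0ℚ
expPartial x (suc m) = expPartial x m +ℚ expTerm x m

-- For x ≥ 0 and p ≥ 0:  p < exp(-x)  ⇔  p · exp(x) < 1
--   ⇔  some rational upper bound s of all partial sums (so s ≥ exp x) has p · s < 1.
LtExpNeg : ℚ → ℚ → Set
LtExpNeg p x = ∃ λ (s : ℚ) → (∀ m → expPartial x m ≤ℚ s) × (p *ℚ s <ℚ 1ℚ)

CountLe : ∀ {n} → (Table n → Set) → ℕ → Set
CountLe {n} P c = Σ (List (Table n)) λ L → (length L ≤ c) × (∀ g → P g → g LM.∈ L)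

ProbLtExpNeg : (n : ℕ) → (Table n → Set) → ℚ → Set
ProbLtExpNeg n P x =
  ∃ λ (c : ℕ) → CountLe P c × LtExpNeg ((+ c / (2 ^ (n * n))) {{m^n≢0 2 (n * n)}}) x

{-# OPTIONS --safe #-}

-- Build the family of edge-disjoint k-sets one block at a time. Call a vertex heavy if it already lies in
-- many blocks; each vertex is used only boundedly often while it is light, so almost all incidences are
-- heavy. By convexity, any set of more than n / B heavy vertices spans so many pairs covered by earlier
-- blocks that some vertex of it has large covered degree inside it. When the vertices of a new block are
-- chosen one by one, each heavy choice therefore either comes from at most n / B vertices or shrinks the
-- available set substantially, and the latter happens at most k / 4 times. Weighting each block by B to the
-- number of its heavy vertices, one finds at most binom(n, k)^m 4^(k m) B^(-k m / 2) families of m blocks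
-- when m is of order n² / k³. For a large constant B the union bound over these families beats both
-- f(k)^m ≤ 2^(c₁ k m) and exp(n² / k²).
module Submission where

open import Defs

-- A plain union bound cannot work for large C. There f(k) can be exponentially large in k, so
-- f(k)^m is of order 2^(c₁ k m), and k m has the same order n² / k² as the target exponent;
-- enlarging m only makes this worse. Edge-disjointness has to save an arbitrarily large constant
-- per incidence of a vertex with a block. The constant B = 4^(c₁ + 8) is this saving, and D is
-- proportional to B. Heaviness is measured against e, of order n / k² and at most an eighth of the
-- average degree m k / n. Hence at most 2 e n ≤ k m / 4 incidences are light and at most h m ≤ k m
-- / 4 are shrinking, and half of all incidences remain to save the factor B. The number of heavy
-- vertices is controlled only in total, not for a single block. The weight of a block is therefore
-- exchanged against the drop of a potential, the number of light uses that the vertices have left,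
-- which makes an induction over the blocks possible.

module Binomial where
  open import Data.Nat
  open import Data.Nat.Properties
  open import Data.Nat.Combinatorics using (_C_; nC1≡n; nCk+nC[k+1]≡[n+1]C[k+1]; nCn≡1; nCk≡nC[n∸k])
  open import Data.Nat.Tactic.RingSolver using (solve-∀)
  open import Data.Product using (_,_)
  open import Relation.Nullary using (yes; no; contradiction)
  open import Relation.Binary.PropositionalEquality

  -- Elementary estimates for binomial coefficients

  nC0≡1 : ∀ n → n C 0 ≡ 1
  nC0≡1 n = trans (nCk≡nC[n∸k] {0} {n} z≤n) (nCn≡1 n)

  -- The ratio rule (j+1) C(n, j+1) = (n - j) C(n, j), with the subtraction moved to the left so
  -- that j > n is covered too. Pascal's rule reduces it to the same identity for n - 1.
  C-absorption : ∀ n j → suc j * (n C suc j) + j * (n C j) ≡ n * (n C j)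
  C-absorption zero zero    = refl
  C-absorption zero (suc j) =
    trans (sym (*-distribʳ-+ 0 (suc (suc j)) (suc j))) (*-zeroʳ (suc (suc j) + suc j))
  C-absorption (suc n) zero = begin
    1 * (suc n C 1) + 0     ≡⟨ trans (+-identityʳ _) (*-identityˡ _) ⟩
    suc n C 1               ≡⟨ nC1≡n (suc n) ⟩
    suc n                   ≡⟨ sym (*-identityʳ (suc n)) ⟩
    suc n * 1               ≡⟨ cong (suc n *_) (sym (nC0≡1 (suc n))) ⟩
    suc n * (suc n C 0)     ∎
    where open ≡-Reasoning
  C-absorption (suc n) (suc i) = begin
    suc (suc i) * (suc n C suc (suc i)) + suc i * (suc n C suc i)
      ≡⟨ cong₂ (λ x y → suc (suc i) * x + suc i * y) (sym (nCk+nC[k+1]≡[n+1]C[k+1] n (suc i)))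
                                                     (sym (nCk+nC[k+1]≡[n+1]C[k+1] n i)) ⟩
    suc (suc i) * (c₁ + c₂) + suc i * (c₀ + c₁)
      ≡⟨ regroup i c₀ c₁ c₂ ⟩
    (suc (suc i) * c₂ + suc i * c₁) + (suc i * c₁ + i * c₀) + (c₀ + c₁)
      ≡⟨ cong₂ (λ x y → x + y + (c₀ + c₁)) (C-absorption n (suc i)) (C-absorption n i) ⟩
    n * c₁ + n * c₀ + (c₀ + c₁)
      ≡⟨ collect n c₀ c₁ ⟩
    suc n * (c₀ + c₁)
      ≡⟨ cong (suc n *_) (nCk+nC[k+1]≡[n+1]C[k+1] n i) ⟩
    suc n * (suc n C suc i) ∎
    where
    open ≡-Reasoning
    c₀ c₁ c₂ : ℕ
    c₀ = n C i
    c₁ = n C suc i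
    c₂ = n C suc (suc i)
    regroup : ∀ i a b c → suc (suc i) * (b + c) + suc i * (a + b)
                          ≡ (suc (suc i) * c + suc i * b) + (suc i * b + i * a) + (a + b)
    regroup = solve-∀
    collect : ∀ n a b → n * b + n * a + (a + b) ≡ suc n * (a + b)
    collect = solve-∀

  2*nC2+n≡n*n : ∀ n → 2 * (n C 2) + n ≡ n * n
  2*nC2+n≡n*n n = trans (cong (2 * (n C 2) +_) (trans (sym (nC1≡n n)) (sym (*-identityˡ _))))
                        (trans (C-absorption n 1) (cong (n *_) (nC1≡n n)))

  nC2≤n*n : ∀ n → n C 2 ≤ n * n
  nC2≤n*n n = begin
    n C 2           ≤⟨ m≤m+n (n C 2) _ ⟩
    2 * (n C 2)     ≤⟨ m≤m+n _ n ⟩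
    2 * (n C 2) + n ≡⟨ 2*nC2+n≡n*n n ⟩
    n * n           ∎
    where open ≤-Reasoning

  nCk≤2^n : ∀ n k → n C k ≤ 2 ^ n
  nCk≤2^n n       zero    = ≤-trans (≤-reflexive (nC0≡1 n)) (m^n>0 2 n)
  nCk≤2^n zero    (suc k) = z≤n
  nCk≤2^n (suc n) (suc k) = begin
    suc n C suc k       ≡⟨ sym (nCk+nC[k+1]≡[n+1]C[k+1] n k) ⟩
    n C k + n C suc k   ≤⟨ +-mono-≤ (nCk≤2^n n k) (nCk≤2^n n (suc k)) ⟩
    2 ^ n + 2 ^ n       ≡⟨ cong (2 ^ n +_) (sym (+-identityʳ _)) ⟩
    2 ^ suc n           ∎
    where open ≤-Reasoning

  -- The product (m+1) ... (m+i) has i factors above m. This compares m^i / i! with a binomial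
  -- coefficient, hence with a power of 2, which is how the exponential series is bounded.
  m^i≤i!*[m+i]Ci : ∀ m i → m ^ i ≤ i ! * ((m + i) C i)
  m^i≤i!*[m+i]Ci m zero    = ≤-reflexive (sym (trans (*-identityˡ _) (nC0≡1 (m + 0))))
  m^i≤i!*[m+i]Ci m (suc i) = begin
    m * m ^ i                             ≤⟨ *-mono-≤ (≤-trans (m≤m+n m i) (n≤1+n _)) (m^i≤i!*[m+i]Ci m i) ⟩
    suc (m + i) * (i ! * ((m + i) C i))   ≡⟨ swap (suc (m + i)) (i !) ((m + i) C i) ⟩
    i ! * (suc (m + i) * ((m + i) C i))   ≡⟨ cong (i ! *_) (sym step) ⟩
    i ! * (suc i * (suc (m + i) C suc i)) ≡⟨ regroup (i !) (suc i) _ ⟩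
    suc i ! * (suc (m + i) C suc i)       ≡⟨ cong (λ z → suc i ! * (z C suc i)) (sym (+-suc m i)) ⟩
    suc i ! * ((m + suc i) C suc i)       ∎
    where
    open ≤-Reasoning
    swap : ∀ a b c → a * (b * c) ≡ b * (a * c)
    swap = solve-∀
    regroup : ∀ a b c → a * (b * c) ≡ b * a * c
    regroup = solve-∀
    split : ∀ i a b → suc i * (a + b) ≡ (suc i * b + i * a) + a
    split = solve-∀
    step : suc i * (suc (m + i) C suc i) ≡ suc (m + i) * ((m + i) C i)
    step = trans (cong (suc i *_) (sym (nCk+nC[k+1]≡[n+1]C[k+1] (m + i) i)))
          (trans (split i ((m + i) C i) _)
          (trans (cong (_+ (m + i) C i) (C-absorption (m + i) i)) (+-comm _ ((m + i) C i))))

  -- Each of the k factors of n (n-1) ... (n-k+1) is at least n / 2.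
  n^k≤2^k*k!*nCk : ∀ n k → 2 * k ≤ n → n ^ k ≤ 2 ^ k * (k ! * (n C k))
  n^k≤2^k*k!*nCk n zero    _    = ≤-reflexive (sym (trans (*-identityˡ _) (trans (*-identityˡ _) (nC0≡1 n))))
  n^k≤2^k*k!*nCk n (suc k) 2k≤n = begin
    n * n ^ k                                 ≤⟨ *-monoʳ-≤ n (n^k≤2^k*k!*nCk n k 2k≤n′) ⟩
    n * (2 ^ k * (k ! * (n C k)))             ≡⟨ pull n (2 ^ k) (k !) (n C k) ⟩
    2 ^ k * (k ! * (n * (n C k)))             ≤⟨ *-monoʳ-≤ (2 ^ k) (*-monoʳ-≤ (k !) ratio) ⟩
    2 ^ k * (k ! * (2 * (suc k * (n C suc k)))) ≡⟨ regroup (2 ^ k) (k !) (suc k) (n C suc k) ⟩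
    2 ^ suc k * (suc k ! * (n C suc k))       ∎
    where
    open ≤-Reasoning
    2k≤n′ : 2 * k ≤ n
    2k≤n′ = ≤-trans (*-monoʳ-≤ 2 (n≤1+n k)) 2k≤n
    pull : ∀ n a b c → n * (a * (b * c)) ≡ a * (b * (n * c))
    pull = solve-∀
    regroup : ∀ a b s c → a * (b * (2 * (s * c))) ≡ 2 * a * (s * b * c)
    regroup = solve-∀
    double : ∀ a b → 2 * (a + b) ≡ 2 * a + 2 * b
    double = solve-∀
    ratio : n * (n C k) ≤ 2 * (suc k * (n C suc k))
    ratio = +-cancelʳ-≤ (n * (n C k)) _ _ (begin
      n * (n C k) + n * (n C k)                              ≡⟨ cong (n * (n C k) +_) (sym (+-identityʳ _)) ⟩
      2 * (n * (n C k))                                      ≡⟨ cong (2 *_) (sym (C-absorption n k)) ⟩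
      2 * (suc k * (n C suc k) + k * (n C k))                ≡⟨ double (suc k * (n C suc k)) _ ⟩
      2 * (suc k * (n C suc k)) + 2 * (k * (n C k))          ≡⟨ cong (2 * (suc k * (n C suc k)) +_) (sym (*-assoc 2 k (n C k))) ⟩
      2 * (suc k * (n C suc k)) + 2 * k * (n C k)            ≤⟨ +-monoʳ-≤ _ (*-monoˡ-≤ (n C k) 2k≤n′) ⟩
      2 * (suc k * (n C suc k)) + n * (n C k)                ∎)

  C-increasing : ∀ n k c → 2 * (k + c) ≤ n → n C k ≤ n C (k + c)
  C-increasing n k zero    _  = ≤-reflexive (cong (n C_) (sym (+-identityʳ k)))
  C-increasing n k (suc c) 2≤ = ≤-trans (C-increasing n k c (≤-trans (m≤m+n _ 2) 2j+2≤n))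
                                  (≤-trans step (≤-reflexive (cong (n C_) (sym (+-suc k c)))))
    where
    open ≤-Reasoning
    j : ℕ
    j = k + c
    expand : ∀ j → 2 * j + 2 ≡ 2 * suc j
    expand = solve-∀
    split : ∀ j x → suc j * x + j * x ≡ (2 * j + 1) * x
    split = solve-∀
    2j+2≤n : 2 * j + 2 ≤ n
    2j+2≤n = ≤-trans (≤-reflexive (trans (expand j) (cong (2 *_) (sym (+-suc k c))))) 2≤
    step : n C j ≤ n C suc j
    step = *-cancelˡ-≤ (suc j) (+-cancelʳ-≤ (j * (n C j)) _ _ (begin
      suc j * (n C j) + j * (n C j)     ≡⟨ split j (n C j) ⟩
      (2 * j + 1) * (n C j)             ≤⟨ *-monoˡ-≤ (n C j) (≤-trans (+-monoʳ-≤ (2 * j) (n≤1+n 1)) 2j+2≤n) ⟩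
      n * (n C j)                       ≡⟨ sym (C-absorption n j) ⟩
      suc j * (n C suc j) + j * (n C j) ∎))

  nC[k+c]≤n^c*nCk : ∀ n k c → n C (k + c) ≤ n ^ c * (n C k)
  nC[k+c]≤n^c*nCk n k zero    = ≤-reflexive (trans (cong (n C_) (+-identityʳ k)) (sym (*-identityˡ _)))
  nC[k+c]≤n^c*nCk n k (suc c) = begin
    n C (k + suc c)             ≡⟨ cong (n C_) (+-suc k c) ⟩
    n C suc (k + c)             ≤⟨ m≤m+n _ _ ⟩
    suc (k + c) * (n C suc (k + c)) ≤⟨ m≤m+n _ _ ⟩
    suc (k + c) * (n C suc (k + c)) + (k + c) * (n C (k + c)) ≡⟨ C-absorption n (k + c) ⟩
    n * (n C (k + c))           ≤⟨ *-monoʳ-≤ n (nC[k+c]≤n^c*nCk n k c) ⟩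
    n * (n ^ c * (n C k))       ≡⟨ sym (*-assoc n (n ^ c) (n C k)) ⟩
    n ^ suc c * (n C k)         ∎
    where open ≤-Reasoning

  nCk≤n^k : ∀ n k → n C k ≤ n ^ k
  nCk≤n^k n k = ≤-trans (nC[k+c]≤n^c*nCk n 0 k) (≤-reflexive (trans (cong (n ^ k *_) (nC0≡1 n)) (*-identityʳ _)))

  -- The exact excess is c k + c (c - 1) / 2. The coefficient c + c² is generous: each induction
  -- step may spend 2 k + 2 c k although it needs only k + c.
  [k+c]C2≤ : ∀ k c .{{_ : NonZero k}} → (k + c) C 2 ≤ k C 2 + (c + c * c) * k
  [k+c]C2≤ k zero    = ≤-reflexive (trans (cong (_C 2) (+-identityʳ k)) (sym (+-identityʳ _)))
  [k+c]C2≤ k (suc c) = begin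
    (k + suc c) C 2                                   ≡⟨ cong (_C 2) (+-suc k c) ⟩
    suc (k + c) C 2                                   ≡⟨ sym (nCk+nC[k+1]≡[n+1]C[k+1] (k + c) 1) ⟩
    (k + c) C 1 + (k + c) C 2                         ≤⟨ +-mono-≤ (≤-reflexive (nC1≡n (k + c))) ([k+c]C2≤ k c) ⟩
    k + c + (k C 2 + (c + c * c) * k)                 ≤⟨ +-monoˡ-≤ _ (+-monoʳ-≤ k (m≤m*n c k)) ⟩
    k + c * k + (k C 2 + (c + c * c) * k)             ≤⟨ m≤m+n _ (k + c * k) ⟩
    k + c * k + (k C 2 + (c + c * c) * k) + (k + c * k) ≡⟨ regroup k c (k C 2) ⟩
    k C 2 + (suc c + suc c * suc c) * k               ∎
    where
    open ≤-Reasoning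
    regroup : ∀ k c x → k + c * k + (x + (c + c * c) * k) + (k + c * k) ≡ x + (suc c + suc c * suc c) * k
    regroup = solve-∀

  ^-distribʳ-* : ∀ k a b → (a * b) ^ k ≡ a ^ k * b ^ k
  ^-distribʳ-* zero    a b = refl
  ^-distribʳ-* (suc k) a b = trans (cong (a * b *_) (^-distribʳ-* k a b)) (interchange a b (a ^ k) (b ^ k))
    where
    interchange : ∀ a b c e → a * b * (c * e) ≡ a * c * (b * e)
    interchange = solve-∀

  -- The size of k₀ in terms of n

  ^-cancelˡ-≤ : ∀ k {a b} → a ^ suc k ≤ b ^ suc k → a ≤ b
  ^-cancelˡ-≤ k {a} {b} le with a ≤? b
  ... | yes a≤b = a≤b
  ... | no a≰b  = contradiction le (<⇒≱ (^-monoˡ-< (suc k) (≰⇒> a≰b)))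

  k!≤k^k : ∀ k → k ! ≤ k ^ k
  k!≤k^k zero    = ≤-refl
  k!≤k^k (suc k) = *-monoʳ-≤ (suc k) (≤-trans (k!≤k^k k) (^-monoˡ-≤ k (n≤1+n k)))

  k≤2^k : ∀ k → k ≤ 2 ^ k
  k≤2^k zero    = z≤n
  k≤2^k (suc k) = begin
    suc k         ≤⟨ +-mono-≤ (m^n>0 2 k) (k≤2^k k) ⟩
    2 ^ k + 2 ^ k ≡⟨ cong (2 ^ k +_) (sym (+-identityʳ _)) ⟩
    2 ^ suc k     ∎
    where open ≤-Reasoning

  -- From 6 on, (q+1)² / q² is at most 7/5, and (7/5)² = 49/25 is below 2.
  quartic-growth : ∀ {q} → 6 ≤ q → suc q * suc q * (suc q * suc q) ≤ 2 * (q * q * (q * q))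
  quartic-growth {q} 6≤q = *-cancelˡ-≤ 25 (begin
    25 * (a * a)       ≡⟨ pack a ⟩
    5 * a * (5 * a)    ≤⟨ *-mono-≤ 5a≤7b 5a≤7b ⟩
    7 * b * (7 * b)    ≡⟨ unpack b ⟩
    49 * (b * b)       ≤⟨ *-monoˡ-≤ (b * b) (n≤1+n 49) ⟩
    50 * (b * b)       ≡⟨ regroup (b * b) ⟩
    25 * (2 * (b * b)) ∎)
    where
    open ≤-Reasoning
    a b : ℕ
    a = suc q * suc q
    b = q * q
    pack : ∀ x → 25 * (x * x) ≡ 5 * x * (5 * x)
    pack = solve-∀
    unpack : ∀ x → 7 * x * (7 * x) ≡ 49 * (x * x)
    unpack = solve-∀
    regroup : ∀ x → 50 * x ≡ 25 * (2 * x)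
    regroup = solve-∀
    expand : ∀ q → 5 * (suc q * suc q) ≡ 5 * (q * q) + 10 * q + 5
    expand = solve-∀
    collect : ∀ q → 5 * (q * q) + 11 * q + q ≡ 5 * (q * q) + 2 * 6 * q
    collect = solve-∀
    finish : ∀ q → 5 * (q * q) + 2 * q * q ≡ 7 * (q * q)
    finish = solve-∀
    5a≤7b : 5 * a ≤ 7 * b
    5a≤7b = begin
      5 * a                        ≡⟨ expand q ⟩
      5 * (q * q) + 10 * q + 5     ≤⟨ +-mono-≤ (+-monoʳ-≤ (5 * (q * q)) (*-monoˡ-≤ q (n≤1+n 10))) (≤-trans (n≤1+n 5) 6≤q) ⟩
      5 * (q * q) + 11 * q + q     ≡⟨ collect q ⟩
      5 * (q * q) + 2 * 6 * q      ≤⟨ +-monoʳ-≤ (5 * (q * q)) (*-monoˡ-≤ q (*-monoʳ-≤ 2 6≤q)) ⟩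
      5 * (q * q) + 2 * q * q      ≡⟨ finish q ⟩
      7 * b                        ∎

  quartic≤2^ : ∀ {q r j} → q ≤ 2 ^ r → 4 + (r + r + (r + r)) ≡ j → 16 * (q * q * (q * q)) ≤ 2 ^ j
  quartic≤2^ {q} {r} q≤ refl = begin
    16 * (q * q * (q * q))
      ≤⟨ *-monoʳ-≤ 16 (*-mono-≤ (*-mono-≤ q≤ q≤) (*-mono-≤ q≤ q≤)) ⟩
    16 * (2 ^ r * 2 ^ r * (2 ^ r * 2 ^ r))
      ≡⟨ cong (λ z → 16 * (z * z)) (sym (^-distribˡ-+-* 2 r r)) ⟩
    16 * (2 ^ (r + r) * 2 ^ (r + r))
      ≡⟨ cong (16 *_) (sym (^-distribˡ-+-* 2 (r + r) (r + r))) ⟩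
    16 * 2 ^ (r + r + (r + r))
      ≡⟨ sym (^-distribˡ-+-* 2 4 (r + r + (r + r))) ⟩
    2 ^ (4 + (r + r + (r + r))) ∎
    where open ≤-Reasoning

  -- A unit step doubles the right side and at most doubles the left. The start is q = 26, where 26
  -- ≤ 2^5 gives 16 · 26^4 ≤ 2^(4 + 20); the exponent is then exactly q - 2, the one that `2^j≤n*n`
  -- offers.
  quartic≤exponential : ∀ i {q j} → i + 26 ≡ q → i + 24 ≡ j → 16 * (q * q * (q * q)) ≤ 2 ^ j
  quartic≤exponential zero 26≡q 24≡j =
    quartic≤2^ {r = 5} (≤-trans (≤-reflexive (sym 26≡q)) (m≤m+n 26 6)) 24≡j
  quartic≤exponential (suc i) {suc q} {suc j} q≡ j≡ = begin
    16 * (suc q * suc q * (suc q * suc q))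
      ≤⟨ *-monoʳ-≤ 16 (quartic-growth (≤-trans (≤-trans (m≤m+n 6 20) (m≤n+m 26 i)) (≤-reflexive (suc-injective q≡)))) ⟩
    16 * (2 * (q * q * (q * q)))
      ≡⟨ swap (q * q * (q * q)) ⟩
    2 * (16 * (q * q * (q * q)))
      ≤⟨ *-monoʳ-≤ 2 (quartic≤exponential i (suc-injective q≡) (suc-injective j≡)) ⟩
    2 ^ suc j ∎
    where
    open ≤-Reasoning
    swap : ∀ x → 16 * (2 * x) ≡ 2 * (16 * x)
    swap = solve-∀

  -- Were k₀ < K, then C(n, k₀) ≥ n ≥ 2^(K²) ≥ 2^(C(k₀, 2)), against f(k₀) < 1. The summand 2 K
  -- keeps k₀ below n / 2, where binomial coefficients increase.
  k₀-large : ∀ K {n k₀} → IsK0 n k₀ → 2 ^ (K * K) + 2 * K ≤ n → K ≤ k₀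
  k₀-large K {n} {suc j} (_ , f<1 , _) N≤n with K ≤? suc j
  ... | yes K≤k₀ = K≤k₀
  ... | no K≰k₀  = contradiction f<1 (≤⇒≯ (begin
    2 ^ (suc j C 2)   ≤⟨ ^-monoʳ-≤ 2 (≤-trans (nC2≤n*n (suc j)) (*-mono-≤ k₀≤K k₀≤K)) ⟩
    2 ^ (K * K)       ≤⟨ m+n≤o⇒m≤o _ N≤n ⟩
    n                 ≡⟨ sym (nC1≡n n) ⟩
    n C 1             ≤⟨ C-increasing n 1 j (≤-trans (*-monoʳ-≤ 2 k₀≤K) (m+n≤o⇒n≤o (2 ^ (K * K)) N≤n)) ⟩
    n C suc j         ∎))
    where
    open ≤-Reasoning
    k₀≤K : suc j ≤ K
    k₀≤K = <⇒≤ (≰⇒> K≰k₀)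

  -- Minimality gives f(k₀ - 1) ≥ 1, so 2^(C(j+1, 2)) ≤ n^(j+1) for j + 1 = k₀ - 1. As C(j+1, 2) = j
  -- (j+1) / 2, after squaring a root of order j + 1 can be taken.
  2^j≤n*n : ∀ {n j} → IsK0 n (suc (suc j)) → 2 ^ j ≤ n * n
  2^j≤n*n {n} {j} (_ , _ , minimal) = ^-cancelˡ-≤ j (begin
    (2 ^ j) ^ suc j                     ≡⟨ ^-*-assoc 2 j (suc j) ⟩
    2 ^ (j * suc j)                     ≡⟨ cong (2 ^_) (sym (+-cancelʳ-≡ (suc j) _ _ (trans (2*nC2+n≡n*n (suc j)) (expand j)))) ⟩
    2 ^ (2 * (suc j C 2))               ≡⟨ cong (2 ^_) (*-comm 2 (suc j C 2)) ⟩
    2 ^ ((suc j C 2) * 2)               ≡⟨ sym (^-*-assoc 2 (suc j C 2) 2) ⟩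
    (2 ^ (suc j C 2)) ^ 2               ≤⟨ ^-monoˡ-≤ 2 (≤-trans (≮⇒≥ (minimal (suc j) (s≤s z≤n) (n<1+n (suc j)))) (nCk≤n^k n (suc j))) ⟩
    (n ^ suc j) ^ 2                     ≡⟨ square (n ^ suc j) ⟩
    n ^ suc j * n ^ suc j               ≡⟨ sym (^-distribʳ-* (suc j) n n) ⟩
    (n * n) ^ suc j                     ∎)
    where
    open ≤-Reasoning
    expand : ∀ j → suc j * suc j ≡ j * suc j + suc j
    expand = solve-∀
    square : ∀ x → x ^ 2 ≡ x * x
    square x = cong (x *_) (*-identityʳ x)

  square-cancel-≤ : ∀ {a b} → a * a ≤ b * b → a ≤ b
  square-cancel-≤ {a} {b} le with a ≤? b
  ... | yes a≤b = a≤b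
  ... | no a≰b  = contradiction le (<⇒≱ (*-mono-< (≰⇒> a≰b) (≰⇒> a≰b)))

  -- The square root of 16 k₀^4 ≤ 2^(k₀ - 2) ≤ n². The factor 4 leaves room for k as large as 2 k₀.
  4k₀²≤n : ∀ {n k₀} → IsK0 n k₀ → 26 ≤ k₀ → 4 * (k₀ * k₀) ≤ n
  4k₀²≤n {k₀ = suc zero}            _      (s≤s ())
  4k₀²≤n {n} {k₀@(suc (suc j))} k₀-min 26≤k₀ = square-cancel-≤ (begin
    4 * (k₀ * k₀) * (4 * (k₀ * k₀)) ≡⟨ regroup k₀ ⟩
    16 * (k₀ * k₀ * (k₀ * k₀))      ≤⟨ quartic≤exponential (k₀ ∸ 26) k₀≡ (suc-injective (suc-injective
                                         (trans (shift (k₀ ∸ 26)) k₀≡))) ⟩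
    2 ^ j                           ≤⟨ 2^j≤n*n {n} {j} k₀-min ⟩
    n * n                           ∎)
    where
    open ≤-Reasoning
    regroup : ∀ q → 4 * (q * q) * (4 * (q * q)) ≡ 16 * (q * q * (q * q))
    regroup = solve-∀
    shift : ∀ i → 2 + (i + 24) ≡ i + 26
    shift = solve-∀
    k₀≡ : k₀ ∸ 26 + 26 ≡ k₀
    k₀≡ = m∸n+n≡m 26≤k₀

  -- From f(k₀) < 1 follows n^k₀ ≤ 2^k₀ k₀! 2^(C(k₀, 2)). Each of the three factors is at most
  -- 2^(k₀²), and the root of order k₀ remains. It makes a factor n per additional vertex affordable
  -- when C is negative.
  n≤2^3k₀ : ∀ {n k₀} → IsK0 n k₀ → 2 * k₀ ≤ n → n ≤ 2 ^ (3 * k₀)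
  n≤2^3k₀ {n} {k₀@(suc j)} (_ , f<1 , _) 2k₀≤n = ^-cancelˡ-≤ j (begin
    n ^ k₀                                 ≤⟨ n^k≤2^k*k!*nCk n k₀ 2k₀≤n ⟩
    2 ^ k₀ * (k₀ ! * (n C k₀))
      ≤⟨ *-mono-≤ (^-monoʳ-≤ 2 (m≤m*n k₀ k₀)) (*-mono-≤ k₀!≤ (≤-trans (<⇒≤ f<1) (^-monoʳ-≤ 2 (nC2≤n*n k₀)))) ⟩
    2 ^ (k₀ * k₀) * (2 ^ (k₀ * k₀) * 2 ^ (k₀ * k₀)) ≡⟨ cong (2 ^ (k₀ * k₀) *_) (sym (^-distribˡ-+-* 2 (k₀ * k₀) (k₀ * k₀))) ⟩
    2 ^ (k₀ * k₀) * 2 ^ (k₀ * k₀ + k₀ * k₀)         ≡⟨ sym (^-distribˡ-+-* 2 (k₀ * k₀) _) ⟩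
    2 ^ (k₀ * k₀ + (k₀ * k₀ + k₀ * k₀))             ≡⟨ cong (2 ^_) (triple k₀) ⟩
    2 ^ (3 * k₀ * k₀)                               ≡⟨ sym (^-*-assoc 2 (3 * k₀) k₀) ⟩
    (2 ^ (3 * k₀)) ^ k₀                             ∎)
    where
    open ≤-Reasoning
    triple : ∀ k → k * k + (k * k + k * k) ≡ 3 * k * k
    triple = solve-∀
    k₀!≤ : k₀ ! ≤ 2 ^ (k₀ * k₀)
    k₀!≤ = ≤-trans (k!≤k^k k₀) (≤-trans (^-monoˡ-≤ k₀ (k≤2^k k₀)) (≤-reflexive (^-*-assoc 2 k₀ k₀)))

-- Weighted count of sets that avoid covered pairs

module WeightedCounting where
  open import Data.Bool using (Bool; true; false; _∧_; not; T)
  open import Data.Nat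
  open import Data.Nat.Properties
  open import Data.Nat.Tactic.RingSolver using (solve-∀)
  open import Data.Fin using (Fin; zero; suc)
  open import Data.Fin.Properties using (all?)
  open import Data.Fin.Subset using (Subset)
  open import Data.Vec using ([]; _∷_; lookup; _[_]≔_)
  open import Data.Vec.Properties using (lookup∘update; lookup∘update′)
  open import Data.Product using (_×_; _,_; proj₁)
  open import Relation.Nullary using (Dec; yes; no; does; contradiction)
  open import Relation.Nullary.Decidable using (_×-dec_; _→-dec_)
  open import Relation.Binary.PropositionalEquality
  open import Function using (_∘_; const)
  import Data.Bool.Properties as Bool
  import Data.Fin.Properties as Fin
  open import Algebra.Properties.Semiring.Sum +-*-semiring using (sum; ∑-distrib-+; *-distribˡ-sum; sum-cong-≗)

  ι : Bool → ℕ
  ι true  = 1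
  ι false = 0

  ι≤1 : ∀ b → ι b ≤ 1
  ι≤1 true  = ≤-refl
  ι≤1 false = z≤n

  T⇒≡true : ∀ {b} → T b → b ≡ true
  T⇒≡true {true} _ = refl

  ≡true⇒T : ∀ {b} → b ≡ true → T b
  ≡true⇒T refl = _

  card : ∀ {n} → (Fin n → Bool) → ℕ
  card A = sum (ι ∘ A)

  sum-mono : ∀ {n} {f g : Fin n → ℕ} → (∀ i → f i ≤ g i) → sum f ≤ sum g
  sum-mono {zero}  f≤g = z≤n
  sum-mono {suc n} f≤g = +-mono-≤ (f≤g zero) (sum-mono (f≤g ∘ suc))

  sum-const : ∀ n c → sum {n} (const c) ≡ n * c
  sum-const zero    c = refl
  sum-const (suc n) c = cong (c +_) (sum-const n c)

  weight : ∀ {n} → (Fin n → ℕ) → Subset n → ℕ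
  weight w S = sum (λ x → ι (lookup S x) * w x)

  size : ∀ {n} → Subset n → ℕ
  size = weight (const 1)

  infixl 6 _∖_
  _∖_ : ∀ {n} → Subset n → Fin n → Subset n
  S ∖ x = S [ x ]≔ false

  weight-∖ : ∀ {n} (w : Fin n → ℕ) S x → weight w S ≡ ι (lookup S x) * w x + weight w (S ∖ x)
  weight-∖ w (b ∷ S) zero    = refl
  weight-∖ w (b ∷ S) (suc x) =
    trans (cong (ι b * w zero +_) (weight-∖ (w ∘ suc) S x))
          (shuffle (ι b * w zero) (ι (lookup S x) * w (suc x)) _)
    where
    shuffle : ∀ a b c → a + (b + c) ≡ b + (a + c)
    shuffle = solve-∀

  ∈-∖ : ∀ {n} (S : Subset n) x y → lookup (S ∖ x) y ≡ true → lookup S y ≡ true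
  ∈-∖ S x y y∈ with y Fin.≟ x
  ... | yes refl = contradiction (trans (sym (lookup∘update x S false)) y∈) λ ()
  ... | no y≢x   = trans (sym (lookup∘update′ y≢x S false)) y∈

  ∑ₛ : ∀ n → (Subset n → ℕ) → ℕ
  ∑ₛ zero    f = f []
  ∑ₛ (suc n) f = ∑ₛ n (f ∘ (true ∷_)) + ∑ₛ n (f ∘ (false ∷_))

  ∑ₛ-mono : ∀ n {f g : Subset n → ℕ} → (∀ S → f S ≤ g S) → ∑ₛ n f ≤ ∑ₛ n g
  ∑ₛ-mono zero    f≤g = f≤g []
  ∑ₛ-mono (suc n) f≤g = +-mono-≤ (∑ₛ-mono n (f≤g ∘ (true ∷_))) (∑ₛ-mono n (f≤g ∘ (false ∷_)))

  *-distribˡ-∑ₛ : ∀ n c (f : Subset n → ℕ) → c * ∑ₛ n f ≡ ∑ₛ n (λ S → c * f S)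
  *-distribˡ-∑ₛ zero    c f = refl
  *-distribˡ-∑ₛ (suc n) c f =
    trans (*-distribˡ-+ c (∑ₛ n (f ∘ (true ∷_))) (∑ₛ n (f ∘ (false ∷_))))
          (cong₂ _+_ (*-distribˡ-∑ₛ n c (f ∘ (true ∷_))) (*-distribˡ-∑ₛ n c (f ∘ (false ∷_))))

  ∑ₛ-sum-comm : ∀ n {p} (f : Fin p → Subset n → ℕ) →
                ∑ₛ n (λ S → sum (λ x → f x S)) ≡ sum (λ x → ∑ₛ n (f x))
  ∑ₛ-sum-comm zero    f = refl
  ∑ₛ-sum-comm (suc n) f =
    trans (cong₂ _+_ (∑ₛ-sum-comm n (λ x → f x ∘ (true ∷_))) (∑ₛ-sum-comm n (λ x → f x ∘ (false ∷_))))
          (sym (∑-distrib-+ (λ x → ∑ₛ n (f x ∘ (true ∷_))) (λ x → ∑ₛ n (f x ∘ (false ∷_)))))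

  ∑ₛ-zero : ∀ n → ∑ₛ n (const 0) ≡ 0
  ∑ₛ-zero zero    = refl
  ∑ₛ-zero (suc n) = cong₂ _+_ (∑ₛ-zero n) (∑ₛ-zero n)

  -- Deleting x is injective on the sets that contain x.
  ∑ₛ-∖ : ∀ {n} (F : Subset n → ℕ) x → ∑ₛ n (λ S → ι (lookup S x) * F (S ∖ x)) ≤ ∑ₛ n F
  ∑ₛ-∖ {suc n} F zero    = begin
    ∑ₛ n (λ S → 1 * F (false ∷ S)) + ∑ₛ n (const 0) ≡⟨ cong (∑ₛ n (λ S → 1 * F (false ∷ S)) +_) (∑ₛ-zero n) ⟩
    ∑ₛ n (λ S → 1 * F (false ∷ S)) + 0              ≡⟨ +-identityʳ _ ⟩
    ∑ₛ n (λ S → 1 * F (false ∷ S))                  ≤⟨ ∑ₛ-mono n (λ S → ≤-reflexive (*-identityˡ _)) ⟩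
    ∑ₛ n (F ∘ (false ∷_))                           ≤⟨ m≤n+m _ _ ⟩
    ∑ₛ n (F ∘ (true ∷_)) + ∑ₛ n (F ∘ (false ∷_))    ∎
    where open ≤-Reasoning
  ∑ₛ-∖ {suc n} F (suc x) = +-mono-≤ (∑ₛ-∖ (F ∘ (true ∷_)) x) (∑ₛ-∖ (F ∘ (false ∷_)) x)

  ∑ₛ-empty : ∀ n → ∑ₛ n (λ S → ι (size S ≡ᵇ 0)) ≡ 1
  ∑ₛ-empty zero    = refl
  ∑ₛ-empty (suc n) = cong₂ _+_ (∑ₛ-zero n) (∑ₛ-empty n)

  weight≤size : ∀ {n} (w : Fin n → ℕ) → (∀ x → w x ≤ 1) → ∀ S → weight w S ≤ size S
  weight≤size w w≤1 S = sum-mono (λ x → *-monoʳ-≤ (ι (lookup S x)) (w≤1 x))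

  Independent : ∀ {n} → (Fin n → Fin n → ℕ) → Subset n → Set
  Independent c S = ∀ x y → lookup S x ≡ true → lookup S y ≡ true → c x y ≡ 0

  Admissible : ∀ {n} → (Fin n → Fin n → ℕ) → (Fin n → Bool) → ℕ → Subset n → Set
  Admissible c A r S = size S ≡ r × (∀ x → lookup S x ≡ true → A x ≡ true) × Independent c S

  abstract
    admissible? : ∀ {n} c (A : Fin n → Bool) r S → Dec (Admissible c A r S)
    admissible? c A r S =
      (size S ≟ r)
      ×-dec all? (λ x → (lookup S x Bool.≟ true) →-dec (A x Bool.≟ true))
      ×-dec all? (λ x → all? (λ y → (lookup S x Bool.≟ true) →-dec (lookup S y Bool.≟ true) →-dec (c x y ≟ 0)))

  module WeightedCount {n} (B d : ℕ) .{{_ : NonZero B}} .{{_ : NonZero d}}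
                       (c : Fin n → Fin n → ℕ) (heavy : Fin n → Bool) where

    nbr : (Fin n → Bool) → Fin n → Fin n → Bool
    nbr A x y = A y ∧ not (c x y ≡ᵇ 0)

    -- The pool left after x has been chosen. The vertex x itself stays in it when `c x x` is zero,
    -- which only enlarges the count.
    rest : (Fin n → Bool) → Fin n → Fin n → Bool
    rest A x y = A y ∧ (c x y ≡ᵇ 0)

    -- The heavy candidates whose choice removes fewer than d vertices from the pool; these are the
    -- ones that have to be few.
    low : (Fin n → Bool) → Fin n → Bool
    low A x = A x ∧ (heavy x ∧ (card (nbr A x) <ᵇ d))

    mass : Subset n → ℕ
    mass = weight (ι ∘ heavy)

    F : (Fin n → Bool) → ℕ → Subset n → ℕ
    F A r S = ι (does (admissible? c A r S)) * B ^ mass S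

    cost : Fin n → ℕ
    cost x = B ^ ι (heavy x)

    nbr+rest : ∀ A x → card (nbr A x) + card (rest A x) ≡ card A
    nbr+rest A x = trans (sym (∑-distrib-+ (ι ∘ nbr A x) (ι ∘ rest A x))) (sum-cong-≗ pointwise)
      where
      split : ∀ a b → ι (a ∧ not b) + ι (a ∧ b) ≡ ι a
      split true  true  = refl
      split true  false = refl
      split false b     = refl
      pointwise : ∀ y → ι (nbr A x y) + ι (rest A x y) ≡ ι (A y)
      pointwise y = split (A y) (c x y ≡ᵇ 0)

    admissible-∖ : ∀ A r S x → lookup S x ≡ true → Admissible c A (suc r) S → Admissible c (rest A x) r (S ∖ x)
    admissible-∖ A r S x x∈S (size≡ , S⊆A , indep) =
      suc-injective (trans (sym size-step) size≡)
      , (λ y y∈ → inRest y (S⊆A y (∈-∖ S x y y∈)) (indep x y x∈S (∈-∖ S x y y∈)))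
      , (λ y z y∈ z∈ → indep y z (∈-∖ S x y y∈) (∈-∖ S x z z∈))
      where
      size-step : size S ≡ suc (size (S ∖ x))
      size-step = trans (weight-∖ (const 1) S x) (cong (λ b → ι b * 1 + size (S ∖ x)) x∈S)
      inRest : ∀ y → A y ≡ true → c x y ≡ 0 → rest A x y ≡ true
      inRest y Ay c≡0 rewrite Ay | c≡0 = refl

    F-∖ : ∀ A r S x → lookup S x ≡ true → Admissible c A (suc r) S →
          F A (suc r) S ≤ ι (A x) * (cost x * F (rest A x) r (S ∖ x))
    F-∖ A r S x x∈S adm@(_ , S⊆A , _)
      with admissible? c A (suc r) S | admissible? c (rest A x) r (S ∖ x)
    ... | no ¬p | _     = contradiction adm ¬p
    ... | yes _ | no ¬q = contradiction (admissible-∖ A r S x x∈S adm) ¬q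
    ... | yes _ | yes _ rewrite S⊆A x x∈S = ≤-reflexive (begin-equality
      1 * B ^ mass S                           ≡⟨ *-identityˡ _ ⟩
      B ^ mass S                               ≡⟨ cong (B ^_) (weight-∖ (ι ∘ heavy) S x) ⟩
      B ^ (ι (lookup S x) * ι (heavy x) + mass (S ∖ x))
        ≡⟨ cong (λ b → B ^ (ι b * ι (heavy x) + mass (S ∖ x))) x∈S ⟩
      B ^ (1 * ι (heavy x) + mass (S ∖ x))     ≡⟨ cong (λ e → B ^ (e + mass (S ∖ x))) (*-identityˡ (ι (heavy x))) ⟩
      B ^ (ι (heavy x) + mass (S ∖ x))         ≡⟨ ^-distribˡ-+-* B (ι (heavy x)) (mass (S ∖ x)) ⟩
      cost x * B ^ mass (S ∖ x)                ≡⟨ cong (cost x *_) (sym (*-identityˡ _)) ⟩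
      cost x * (1 * B ^ mass (S ∖ x))          ≡⟨ sym (*-identityˡ _) ⟩
      1 * (cost x * (1 * B ^ mass (S ∖ x)))    ∎)
      where open ≤-Reasoning

    -- Every member of an admissible set may be the one chosen first, so the set is counted r + 1
    -- times. Iteration turns this into the factor r!.
    peel : ∀ A r S → suc r * F A (suc r) S
                     ≤ sum (λ x → ι (lookup S x) * (ι (A x) * (cost x * F (rest A x) r (S ∖ x))))
    peel A r S with does (admissible? c A (suc r) S) in eq
    ... | false = ≤-trans (≤-reflexive (*-zeroʳ (suc r))) z≤n
    ... | true  = begin
      suc r * (1 * B ^ mass S)                       ≡⟨ cong (λ s → s * (1 * B ^ mass S)) (sym (proj₁ adm)) ⟩
      size S * (1 * B ^ mass S)                      ≡⟨ *-comm (size S) _ ⟩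
      1 * B ^ mass S * size S                        ≡⟨ *-distribˡ-sum (1 * B ^ mass S) (λ x → ι (lookup S x) * 1) ⟩
      sum (λ x → 1 * B ^ mass S * (ι (lookup S x) * 1)) ≤⟨ sum-mono pointwise ⟩
      sum (λ x → ι (lookup S x) * (ι (A x) * (cost x * F (rest A x) r (S ∖ x)))) ∎
      where
      open ≤-Reasoning
      adm : Admissible c A (suc r) S
      adm with admissible? c A (suc r) S
      ... | yes p = p
      ... | no _  = contradiction eq λ ()
      F≡ : F A (suc r) S ≡ 1 * B ^ mass S
      F≡ = cong (λ b → ι b * B ^ mass S) eq
      pointwise : ∀ x → 1 * B ^ mass S * (ι (lookup S x) * 1)
                        ≤ ι (lookup S x) * (ι (A x) * (cost x * F (rest A x) r (S ∖ x)))
      pointwise x with lookup S x in x∈S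
      ... | false = ≤-reflexive (*-zeroʳ (1 * B ^ mass S))
      ... | true  = begin
        1 * B ^ mass S * 1 ≡⟨ *-identityʳ _ ⟩
        1 * B ^ mass S     ≡⟨ sym F≡ ⟩
        F A (suc r) S      ≤⟨ F-∖ A r S x x∈S adm ⟩
        ι (A x) * (cost x * F (rest A x) r (S ∖ x)) ≡⟨ sym (*-identityˡ _) ⟩
        1 * (ι (A x) * (cost x * F (rest A x) r (S ∖ x))) ∎

    F-zero : ∀ A → ∑ₛ n (F A 0) ≤ 1
    F-zero A = ≤-trans (∑ₛ-mono n pointwise) (≤-reflexive (∑ₛ-empty n))
      where
      pointwise : ∀ S → F A 0 S ≤ ι (size S ≡ᵇ 0)
      pointwise S with admissible? c A 0 S
      ... | no _ = z≤n
      ... | yes (size≡0 , _) rewrite size≡0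
                                   | n≤0⇒n≡0 (≤-trans (weight≤size (ι ∘ heavy) (ι≤1 ∘ heavy) S) (≤-reflexive size≡0))
                                   = ≤-refl

    module _ (sparse : ∀ A → B * card (low A) ≤ n) where

      -- Removing x ∈ S from S replaces A by rest A x. A heavy vertex that is not low shrinks A by d, so it
      -- can occur only h times; low vertices have at most n / B choices, which pays for their weight B.
      ∑F≤ : ∀ r h A → card A ≤ h * d → r ! * ∑ₛ n (F A r) ≤ (2 * n) ^ r * B ^ h
      ∑F≤ zero    h A _    = begin
        1 * ∑ₛ n (F A 0) ≡⟨ *-identityˡ _ ⟩
        ∑ₛ n (F A 0)     ≤⟨ F-zero A ⟩
        1                ≤⟨ m^n>0 B h ⟩
        B ^ h            ≡⟨ sym (*-identityˡ _) ⟩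
        1 * B ^ h        ∎
        where open ≤-Reasoning
      ∑F≤ (suc r) h A ∣A∣≤ = begin
        suc r ! * ∑ₛ n (F A (suc r))
          ≡⟨ regroup (suc r) (r !) _ ⟩
        r ! * (suc r * ∑ₛ n (F A (suc r)))
          ≡⟨ cong (r ! *_) (*-distribˡ-∑ₛ n (suc r) (F A (suc r))) ⟩
        r ! * ∑ₛ n (λ S → suc r * F A (suc r) S)
          ≤⟨ *-monoʳ-≤ (r !) (∑ₛ-mono n (peel A r)) ⟩
        r ! * ∑ₛ n (λ S → sum (λ x → ι (lookup S x) * G x (S ∖ x)))
          ≡⟨ cong (r ! *_) (∑ₛ-sum-comm n (λ x S → ι (lookup S x) * G x (S ∖ x))) ⟩
        r ! * sum (λ x → ∑ₛ n (λ S → ι (lookup S x) * G x (S ∖ x)))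
          ≤⟨ *-monoʳ-≤ (r !) (sum-mono (λ x → ∑ₛ-∖ (G x) x)) ⟩
        r ! * sum (λ x → ∑ₛ n (G x))
          ≡⟨ *-distribˡ-sum (r !) (λ x → ∑ₛ n (G x)) ⟩
        sum (λ x → r ! * ∑ₛ n (G x))
          ≤⟨ sum-mono (λ x → ≤-trans (≤-reflexive (pull x)) (vertex x)) ⟩
        sum (λ x → M * (1 + B * ι (low A x)))
          ≡⟨ sym (*-distribˡ-sum M (λ x → 1 + B * ι (low A x))) ⟩
        M * sum (λ x → 1 + B * ι (low A x))
          ≡⟨ cong (M *_) (∑-distrib-+ (const 1) (λ x → B * ι (low A x))) ⟩
        M * (sum {n} (const 1) + sum (λ x → B * ι (low A x)))
          ≡⟨ cong₂ (λ a b → M * (a + b)) (trans (sum-const n 1) (*-identityʳ n))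
                                          (sym (*-distribˡ-sum B (ι ∘ low A))) ⟩
        -- Every first vertex contributes at most M, and a low one B M more. Both totals are at most
        -- n M, whence the factor 2 n per chosen vertex.
        M * (n + B * card (low A))
          ≤⟨ *-monoʳ-≤ M (+-monoʳ-≤ n (sparse A)) ⟩
        M * (n + n)
          ≡⟨ collect n ((2 * n) ^ r) (B ^ h) ⟩
        (2 * n) ^ suc r * B ^ h ∎
        where
        open ≤-Reasoning
        G : Fin n → Subset n → ℕ
        G x S = ι (A x) * (cost x * F (rest A x) r S)
        M : ℕ
        M = (2 * n) ^ r * B ^ h
        regroup : ∀ a b c → a * b * c ≡ b * (a * c)
        regroup = solve-∀
        collect : ∀ n p q → p * q * (n + n) ≡ 2 * n * p * q
        collect = solve-∀
        pull : ∀ x → r ! * ∑ₛ n (G x) ≡ ι (A x) * (cost x * (r ! * ∑ₛ n (F (rest A x) r)))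
        pull x = begin-equality
          r ! * ∑ₛ n (G x)
            ≡⟨ cong (r ! *_) (sym (*-distribˡ-∑ₛ n (ι (A x)) (λ S → cost x * F (rest A x) r S))) ⟩
          r ! * (ι (A x) * ∑ₛ n (λ S → cost x * F (rest A x) r S))
            ≡⟨ cong (λ z → r ! * (ι (A x) * z)) (sym (*-distribˡ-∑ₛ n (cost x) (F (rest A x) r))) ⟩
          r ! * (ι (A x) * (cost x * ∑ₛ n (F (rest A x) r)))
            ≡⟨ rotate (r !) (ι (A x)) (cost x) _ ⟩
          ι (A x) * (cost x * (r ! * ∑ₛ n (F (rest A x) r))) ∎
          where
          rotate : ∀ a b c e → a * (b * (c * e)) ≡ b * (c * (a * e))
          rotate = solve-∀
        rest≤ : ∀ x → card (rest A x) ≤ card A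
        rest≤ x = ≤-trans (m≤n+m _ _) (≤-reflexive (nbr+rest A x))
        high : ∀ h x → card A ≤ h * d → d ≤ card (nbr A x) →
               B * (r ! * ∑ₛ n (F (rest A x) r)) ≤ (2 * n) ^ r * B ^ h
        -- With h = 0 the pool is empty, so no vertex has d ≥ 1 neighbours in it.
        high zero    x ∣A∣≤0 d≤ = contradiction
          (≤-trans (>-nonZero⁻¹ d) (≤-trans d≤ (≤-trans (m≤m+n _ _) (≤-trans (≤-reflexive (nbr+rest A x)) ∣A∣≤0)))) λ ()
        high (suc h) x ∣A∣≤hd d≤ = begin
          B * (r ! * ∑ₛ n (F (rest A x) r)) ≤⟨ *-monoʳ-≤ B (∑F≤ r h (rest A x) ∣rest∣≤) ⟩
          B * ((2 * n) ^ r * B ^ h)         ≡⟨ swap B ((2 * n) ^ r) (B ^ h) ⟩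
          (2 * n) ^ r * B ^ suc h           ∎
          where
          swap : ∀ a b c → a * (b * c) ≡ b * (a * c)
          swap = solve-∀
          ∣rest∣≤ : card (rest A x) ≤ h * d
          ∣rest∣≤ = +-cancelˡ-≤ d _ _ (begin
            d + card (rest A x)              ≤⟨ +-monoˡ-≤ _ d≤ ⟩
            card (nbr A x) + card (rest A x) ≡⟨ nbr+rest A x ⟩
            card A                           ≤⟨ ∣A∣≤hd ⟩
            d + h * d                        ∎)
        vertex : ∀ x → ι (A x) * (cost x * (r ! * ∑ₛ n (F (rest A x) r))) ≤ M * (1 + B * ι (low A x))
        vertex x with A x
        ... | false = z≤n
        ... | true with heavy x
        ... | false = begin
          1 * (1 * (r ! * ∑ₛ n (F (rest A x) r))) ≡⟨ trans (*-identityˡ _) (*-identityˡ _) ⟩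
          r ! * ∑ₛ n (F (rest A x) r)             ≤⟨ ∑F≤ r h (rest A x) (≤-trans (rest≤ x) ∣A∣≤) ⟩
          M                                       ≤⟨ m≤m*n M (1 + B * 0) ⟩
          M * (1 + B * 0)                         ∎
        ... | true with card (nbr A x) <ᵇ d in eq
        ... | true = begin
          1 * (B * 1 * (r ! * ∑ₛ n (F (rest A x) r))) ≡⟨ *-identityˡ _ ⟩
          B * 1 * (r ! * ∑ₛ n (F (rest A x) r))
            ≤⟨ *-monoʳ-≤ (B * 1) (∑F≤ r h (rest A x) (≤-trans (rest≤ x) ∣A∣≤)) ⟩
          B * 1 * M                                   ≡⟨ *-comm (B * 1) M ⟩
          M * (B * 1)                                 ≤⟨ *-monoʳ-≤ M (m≤n+m _ 1) ⟩
          M * (1 + B * 1)                             ∎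
        ... | false = begin
          1 * (B * 1 * (r ! * ∑ₛ n (F (rest A x) r))) ≡⟨ trans (*-identityˡ _) (cong (_* (r ! * ∑ₛ n (F (rest A x) r))) (*-identityʳ B)) ⟩
          B * (r ! * ∑ₛ n (F (rest A x) r))
            ≤⟨ high h x ∣A∣≤ (≮⇒≥ λ lt → contradiction (trans (sym eq) (T⇒≡true (<⇒<ᵇ lt))) λ ()) ⟩
          M                                           ≤⟨ m≤m*n M (1 + B * 0) ⟩
          M * (1 + B * 0)                             ∎

-- Degrees in packings and sparsity of low vertices

module Packings where
  open import Data.Bool using (Bool; true; false; not)
  open import Data.Nat
  open import Data.Nat.Properties
  open import Data.Nat.Tactic.RingSolver using (solve-∀)
  open import Data.Fin using (Fin; zero; suc)
  open import Data.Fin.Subset using (Subset)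
  open import Data.Vec using ([]; _∷_; lookup)
  open import Data.List using (List; []; _∷_; length)
  open import Data.Sum using (_⊎_; inj₁; inj₂)
  open import Data.Product using (_,_)
  open import Relation.Nullary using (does; contradiction)
  open import Relation.Binary.PropositionalEquality
  open import Function using (_∘_)
  import Data.Fin.Properties as Fin
  open import Algebra.Properties.Semiring.Sum +-*-semiring using (sum; ∑-distrib-+; *-distribˡ-sum; *-distribʳ-sum; sum-cong-≗)
  open WeightedCounting

  degree : ∀ {n} → List (Subset n) → Fin n → ℕ
  degree []      x = 0
  degree (S ∷ H) x = ι (lookup S x) + degree H x

  -- Removes the diagonal from `codegree`. Otherwise a vertex of an earlier block would conflict
  -- with itself and could never be used again.
  distinct : ∀ {n} → Fin n → Fin n → ℕ
  distinct x y = ι (not (does (x Fin.≟ y)))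

  pairIn : ∀ {n} → Subset n → Fin n → Fin n → ℕ
  pairIn S x y = ι (lookup S x) * ι (lookup S y) * distinct x y

  codegree : ∀ {n} → List (Subset n) → Fin n → Fin n → ℕ
  codegree []      x y = 0
  codegree (S ∷ H) x y = pairIn S x y + codegree H x y

  everything : ∀ {n} → Fin n → Bool
  everything _ = true

  -- Blocks are listed newest first. Edge-disjointness appears as independence from the pairs
  -- covered by the older blocks, the form in which the weighted count needs it.
  data Packing {n} (k : ℕ) : List (Subset n) → Set where
    []  : Packing k []
    _∷_ : ∀ {S H} → Admissible (codegree H) everything k S → Packing k H → Packing k (S ∷ H)

  -- A pair inside a new block was not covered before. Hence counting covered neighbours amounts to
  -- summing codegrees, which links lowness to `within`.
  codegree≤1 : ∀ {n k} {H : List (Subset n)} → Packing k H → ∀ x y → codegree H x y ≤ 1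
  codegree≤1 []                                  x y = z≤n
  codegree≤1 (_∷_ {S} {H} (_ , _ , indep) P) x y
    with lookup S x in x∈S | lookup S y in y∈S
  ... | false | _     = codegree≤1 P x y
  ... | true  | false = codegree≤1 P x y
  ... | true  | true  rewrite indep x y x∈S y∈S =
    ≤-trans (≤-reflexive (trans (+-identityʳ _) (*-identityˡ _))) (ι≤1 _)

  -- The number of light uses still possible: a vertex of degree D can be used θ - D more times
  -- while light, and truncated subtraction gives 0 once it is heavy.
  potential : ∀ {n} → ℕ → List (Subset n) → ℕ
  potential θ H = sum (λ x → θ ∸ degree H x)

  heavy : ∀ {n} → ℕ → List (Subset n) → Fin n → Bool
  heavy θ H x = θ ≤ᵇ degree H x

  -- A light member of S lowers the potential by one, a heavy member leaves it unchanged. The drops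
  -- over all blocks together are at most θ n, the potential of the empty packing.
  potential-∷ : ∀ {n} θ (S : Subset n) H →
    potential θ (S ∷ H) + size S ≡ potential θ H + weight (ι ∘ heavy θ H) S
  potential-∷ θ S H =
    trans (sym (∑-distrib-+ (λ x → θ ∸ degree (S ∷ H) x) (λ x → ι (lookup S x) * 1)))
    (trans (sum-cong-≗ (λ x → pointwise (lookup S x) (degree H x)))
    (∑-distrib-+ (λ x → θ ∸ degree H x) (λ x → ι (lookup S x) * ι (heavy θ H x))))
    where
    pointwise : ∀ b D → (θ ∸ (ι b + D)) + ι b * 1 ≡ (θ ∸ D) + ι b * ι (θ ≤ᵇ D)
    pointwise false D = refl
    pointwise true  D with θ ≤ᵇ D in eq
    ... | true  = cong (_+ 1) (trans (m≤n⇒m∸n≡0 (m≤n⇒m≤1+n θ≤D)) (sym (m≤n⇒m∸n≡0 θ≤D)))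
      where θ≤D = ≤ᵇ⇒≤ θ D (≡true⇒T eq)
    ... | false = begin
      (θ ∸ suc D) + 1 ≡⟨ +-comm _ 1 ⟩
      1 + (θ ∸ suc D) ≡⟨ sym (+-∸-assoc 1 D<θ) ⟩
      suc θ ∸ suc D   ≡⟨ sym (+-identityʳ _) ⟩
      (θ ∸ D) + 0     ∎
      where
      open ≡-Reasoning
      D<θ : suc D ≤ θ
      D<θ = ≰⇒> λ θ≤D → contradiction (trans (sym eq) (T⇒≡true (≤⇒≤ᵇ θ≤D))) λ ()

  sum-distinct : ∀ {n} (g : Fin n → ℕ) x → sum (λ y → g y * distinct x y) + g x ≡ sum g
  sum-distinct g zero    = begin
    g zero * 0 + sum (λ y → g (suc y) * 1) + g zero
      ≡⟨ cong₂ (λ a b → a + b + g zero) (*-zeroʳ (g zero)) (sum-cong-≗ (λ y → *-identityʳ (g (suc y)))) ⟩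
    sum (g ∘ suc) + g zero ≡⟨ +-comm _ (g zero) ⟩
    sum g                  ∎
    where open ≡-Reasoning
  sum-distinct g (suc x) = begin
    g zero * 1 + sum (λ y → g (suc y) * distinct x y) + g (suc x)
      ≡⟨ +-assoc (g zero * 1) _ _ ⟩
    g zero * 1 + (sum (λ y → g (suc y) * distinct x y) + g (suc x))
      ≡⟨ cong₂ _+_ (*-identityʳ (g zero)) (sum-distinct (g ∘ suc) x) ⟩
    sum g ∎
    where open ≡-Reasoning

  within : ∀ {n} → (Fin n → Bool) → (Fin n → Fin n → ℕ) → ℕ
  within L c = sum (λ x → ι (L x) * sum (λ y → ι (L y) * c x y))

  within-+ : ∀ {n} L (c e : Fin n → Fin n → ℕ) →
             within L (λ x y → c x y + e x y) ≡ within L c + within L e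
  within-+ L c e = trans (sum-cong-≗ row)
    (∑-distrib-+ (λ x → ι (L x) * sum (λ y → ι (L y) * c x y)) (λ x → ι (L x) * sum (λ y → ι (L y) * e x y)))
    where
    row : ∀ x → ι (L x) * sum (λ y → ι (L y) * (c x y + e x y))
                ≡ ι (L x) * sum (λ y → ι (L y) * c x y) + ι (L x) * sum (λ y → ι (L y) * e x y)
    row x = trans
      (cong (ι (L x) *_) (trans (sum-cong-≗ (λ y → *-distribˡ-+ (ι (L y)) (c x y) (e x y)))
                                (∑-distrib-+ (λ y → ι (L y) * c x y) (λ y → ι (L y) * e x y))))
      (*-distribˡ-+ (ι (L x)) _ _)

  common : ∀ {n} → (Fin n → Bool) → Subset n → ℕ
  common L S = sum (λ x → ι (L x) * ι (lookup S x))

  within-pairIn : ∀ {n} L (S : Subset n) → within L (pairIn S) + common L S ≡ common L S * common L S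
  within-pairIn L S = begin
    within L (pairIn S) + sum g
      ≡⟨ sym (∑-distrib-+ (λ x → ι (L x) * sum (λ y → ι (L y) * pairIn S x y)) g) ⟩
    sum (λ x → ι (L x) * sum (λ y → ι (L y) * pairIn S x y) + g x)
      ≡⟨ sum-cong-≗ row ⟩
    sum (λ x → g x * sum g)
      ≡⟨ sym (*-distribʳ-sum (sum g) g) ⟩
    sum g * sum g ∎
    where
    open ≡-Reasoning
    g : Fin _ → ℕ
    g x = ι (L x) * ι (lookup S x)
    idem : ∀ a b → ι a * ι b ≡ ι a * ι b * (ι a * ι b)
    idem true  true  = refl
    idem true  false = refl
    idem false _     = refl
    arrange : ∀ a b p q e → a * (b * (p * q * e)) ≡ a * p * (b * q * e)
    arrange = solve-∀
    row : ∀ x → ι (L x) * sum (λ y → ι (L y) * pairIn S x y) + g x ≡ g x * sum g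
    row x = begin
      ι (L x) * sum (λ y → ι (L y) * pairIn S x y) + g x
        ≡⟨ cong₂ _+_
             (trans (*-distribˡ-sum (ι (L x)) (λ y → ι (L y) * pairIn S x y))
             (trans (sum-cong-≗ (λ y → arrange (ι (L x)) (ι (L y)) (ι (lookup S x)) (ι (lookup S y)) (distinct x y)))
                    (sym (*-distribˡ-sum (g x) (λ y → g y * distinct x y)))))
             (idem (L x) (lookup S x)) ⟩
      g x * sum (λ y → g y * distinct x y) + g x * g x
        ≡⟨ sym (*-distribˡ-+ (g x) _ (g x)) ⟩
      g x * (sum (λ y → g y * distinct x y) + g x)
        ≡⟨ cong (g x *_) (sum-distinct g x) ⟩
      g x * sum g ∎

  -- The convexity step: t a ≤ a (a ∸ 1) + t².
  block-convexity : ∀ {n} t L (S : Subset n) → t * common L S ≤ within L (pairIn S) + t * t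
  block-convexity t L S = +-cancelʳ-≤ a _ _ (begin
    t * a + a                           ≤⟨ tangent (≤-total a t) ⟩
    a * a + t * t                       ≡⟨ cong (_+ t * t) (sym (within-pairIn L S)) ⟩
    within L (pairIn S) + a + t * t     ≡⟨ swap _ a (t * t) ⟩
    within L (pairIn S) + t * t + a     ∎)
    where
    open ≤-Reasoning
    a : ℕ
    a = common L S
    swap : ∀ p q r → p + q + r ≡ p + r + q
    swap = solve-∀
    a≤a*a : ∀ a → a ≤ a * a
    a≤a*a zero    = z≤n
    a≤a*a (suc a) = m≤m*n (suc a) (suc a)
    tangent : a ≤ t ⊎ t ≤ a → t * a + a ≤ a * a + t * t
    tangent (inj₁ a≤t) = begin
      t * a + a     ≤⟨ +-mono-≤ (*-monoʳ-≤ t a≤t) (a≤a*a a) ⟩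
      t * t + a * a ≡⟨ +-comm (t * t) (a * a) ⟩
      a * a + t * t ∎
    tangent (inj₂ t≤a) with m≤n⇒m<n∨m≡n t≤a
    ... | inj₁ t<a = begin
      t * a + a     ≡⟨ +-comm (t * a) a ⟩
      suc t * a     ≤⟨ *-monoˡ-≤ a t<a ⟩
      a * a         ≤⟨ m≤m+n _ _ ⟩
      a * a + t * t ∎
    ... | inj₂ t≡a = begin
      t * a + a     ≤⟨ +-mono-≤ (≤-reflexive (cong (_* a) t≡a)) (a≤a*a a) ⟩
      a * a + a * a ≡⟨ cong (λ z → a * a + z * z) (sym t≡a) ⟩
      a * a + t * t ∎

  -- The tangent bound summed over the blocks: the degree sum over L is the sum of the sizes of L ∩
  -- S, and pairs within L add up block by block.
  packing-convexity : ∀ {n} t L (H : List (Subset n)) →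
    t * sum (λ x → ι (L x) * degree H x) ≤ within L (codegree H) + length H * (t * t)
  packing-convexity {n} t L [] = ≤-trans (≤-reflexive (trans (cong (t *_) zeros) (*-zeroʳ t))) z≤n
    where
    zeros : sum (λ x → ι (L x) * 0) ≡ 0
    zeros = trans (sum-cong-≗ (λ x → *-zeroʳ (ι (L x)))) (trans (sum-const n 0) (*-zeroʳ n))
  packing-convexity t L (S ∷ H) = begin
    t * sum (λ x → ι (L x) * (ι (lookup S x) + degree H x))
      ≡⟨ cong (t *_) (trans (sum-cong-≗ (λ x → *-distribˡ-+ (ι (L x)) (ι (lookup S x)) (degree H x)))
                            (∑-distrib-+ (λ x → ι (L x) * ι (lookup S x)) (λ x → ι (L x) * degree H x))) ⟩
    t * (common L S + sum (λ x → ι (L x) * degree H x))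
      ≡⟨ *-distribˡ-+ t _ _ ⟩
    t * common L S + t * sum (λ x → ι (L x) * degree H x)
      ≤⟨ +-mono-≤ (block-convexity t L S) (packing-convexity t L H) ⟩
    (within L (pairIn S) + t * t) + (within L (codegree H) + length H * (t * t))
      ≡⟨ interchange (within L (pairIn S)) (t * t) (within L (codegree H)) (length H * (t * t)) ⟩
    (within L (pairIn S) + within L (codegree H)) + (t * t + length H * (t * t))
      ≡⟨ cong (_+ (t * t + length H * (t * t))) (sym (within-+ L (pairIn S) (codegree H))) ⟩
    within L (codegree (S ∷ H)) + length (S ∷ H) * (t * t) ∎
    where
    open ≤-Reasoning
    interchange : ∀ a b c e → (a + b) + (c + e) ≡ (a + c) + (b + e)
    interchange = solve-∀

  module _ {n k : ℕ} (B t e : ℕ) .{{_ : NonZero B}} .{{t≢0 : NonZero t}} .{{e≢0 : NonZero e}} where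

    private instance
      te≢0 : NonZero (t * e)
      te≢0 = m*n≢0 t e {{t≢0}} {{e≢0}}

    -- A large set of low heavy vertices would have large degree sum, hence by convexity span many pairs
    -- of the packing, whereas by lowness it spans few.
    low-sparse : ∀ {H : List (Subset n)} → Packing k H → B * (length H * t) ≤ n * e →
      ∀ A → B * card (WeightedCount.low B (t * e) (codegree H) (heavy (2 * e) H) A) ≤ n
    low-sparse {H} P few A = *-cancelʳ-≤ _ _ e (begin
      B * ℓ * e          ≡⟨ rotate B ℓ e ⟩
      B * (ℓ * e)        ≤⟨ *-monoʳ-≤ B ℓe≤ ⟩
      B * (length H * t) ≤⟨ few ⟩
      n * e              ∎)
      where
      open ≤-Reasoning
      open WeightedCount B (t * e) (codegree H) (heavy (2 * e) H)
      L : Fin n → Bool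
      L = low A
      ℓ : ℕ
      ℓ = card L
      rotate : ∀ a b c → a * b * c ≡ a * (b * c)
      rotate = solve-∀
      low⇒A : ∀ y → ι (L y) ≤ ι (A y)
      low⇒A y with A y
      ... | true  = ι≤1 _
      ... | false = z≤n
      spanned : ∀ x → ι (L x) * sum (λ y → ι (L y) * codegree H x y) ≤ t * e * ι (L x)
      spanned x with A x | heavy (2 * e) H x | card (nbr A x) <ᵇ t * e in eq
      ... | false | _     | _     = z≤n
      ... | true  | false | _     = z≤n
      ... | true  | true  | false = z≤n
      ... | true  | true  | true  = begin
        1 * sum (λ y → ι (L y) * codegree H x y) ≡⟨ *-identityˡ _ ⟩
        sum (λ y → ι (L y) * codegree H x y)     ≤⟨ sum-mono (λ y → ≤-trans (*-monoˡ-≤ (codegree H x y) (low⇒A y)) (counted y)) ⟩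
        card (nbr A x)                           ≤⟨ <⇒≤ (<ᵇ⇒< _ _ (≡true⇒T eq)) ⟩
        t * e                                    ≡⟨ sym (*-identityʳ _) ⟩
        t * e * 1                                ∎
        where
        counted : ∀ y → ι (A y) * codegree H x y ≤ ι (nbr A x y)
        counted y with A y | codegree H x y | codegree≤1 P x y
        ... | false | _     | _   = z≤n
        ... | true  | zero  | _   = z≤n
        ... | true  | suc z | z≤1 = ≤-trans (≤-reflexive (*-identityˡ (suc z))) z≤1
      few-spanned : within L (codegree H) ≤ t * e * ℓ
      few-spanned = ≤-trans (sum-mono spanned) (≤-reflexive (sym (*-distribˡ-sum (t * e) (ι ∘ L))))
      heavy-degree : ∀ x → 2 * e * ι (L x) ≤ ι (L x) * degree H x
      heavy-degree x with A x | 2 * e ≤ᵇ degree H x in eq | card (nbr A x) <ᵇ t * e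
      ... | false | _     | _     = ≤-reflexive (*-zeroʳ (2 * e))
      ... | true  | false | _     = ≤-reflexive (*-zeroʳ (2 * e))
      ... | true  | true  | false = ≤-reflexive (*-zeroʳ (2 * e))
      ... | true  | true  | true  = begin
        2 * e * 1        ≡⟨ *-identityʳ _ ⟩
        2 * e            ≤⟨ ≤ᵇ⇒≤ _ _ (≡true⇒T eq) ⟩
        degree H x       ≡⟨ sym (*-identityˡ _) ⟩
        1 * degree H x   ∎
      degree-sum : 2 * e * ℓ ≤ sum (λ x → ι (L x) * degree H x)
      degree-sum = ≤-trans (≤-reflexive (*-distribˡ-sum (2 * e) (ι ∘ L))) (sum-mono heavy-degree)
      -- The degree sum is at least 2 e ℓ and the spanned pairs number at most t e ℓ, so half of t ·
      -- 2 e ℓ survives. This is why heaviness starts at 2 e and lowness ends at t e.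
      ℓe≤ : ℓ * e ≤ length H * t
      ℓe≤ = *-cancelˡ-≤ t (+-cancelˡ-≤ (t * e * ℓ) _ _ (begin
        t * e * ℓ + t * (ℓ * e)                      ≡⟨ double t e ℓ ⟩
        t * (2 * e * ℓ)                              ≤⟨ *-monoʳ-≤ t degree-sum ⟩
        t * sum (λ x → ι (L x) * degree H x)         ≤⟨ packing-convexity t L H ⟩
        within L (codegree H) + length H * (t * t)   ≤⟨ +-monoˡ-≤ _ few-spanned ⟩
        t * e * ℓ + length H * (t * t)               ≡⟨ cong (t * e * ℓ +_) (factor (length H) t) ⟩
        t * e * ℓ + t * (length H * t)               ∎))
        where
        double : ∀ t e ℓ → t * e * ℓ + t * (ℓ * e) ≡ t * (2 * e * ℓ)
        double = solve-∀
        factor : ∀ a t → a * (t * t) ≡ t * (a * t)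
        factor = solve-∀

-- Counting the tables that contain a packing of cliques

module CliqueTables where
  open import Data.Bool using (Bool; true; false; _∧_; not; if_then_else_)
  open import Data.Nat
  open import Data.Nat.Properties
  open import Data.Nat.Combinatorics using (_C_; nC1≡n; nCk+nC[k+1]≡[n+1]C[k+1])
  open import Data.Nat.Tactic.RingSolver using (solve-∀)
  open import Data.Fin using (Fin; zero; suc; toℕ)
  open import Data.Fin.Subset using (Subset; ∣_∣; _∈_)
  open import Data.Empty using (⊥; ⊥-elim)
  open import Data.Vec using (Vec; []; _∷_; lookup; here)
  open import Data.Vec.Properties using (lookup⇒[]=)
  open import Data.List using (List; []; _∷_; length; map; _++_; cartesianProductWith)
  open import Data.List.Properties using (length-++; length-map)
  import Data.List.Membership.Propositional as LM
  open import Data.List.Membership.Propositional.Properties using (∈-++⁺ˡ; ∈-++⁺ʳ; ∈-map⁺; ∈-cartesianProductWith⁺)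
  open import Data.List.Relation.Unary.Any using (here)
  open import Data.Sum using (inj₁; inj₂)
  open import Data.Product using (_,_; proj₁; proj₂)
  open import Relation.Nullary using (yes; no; does; contradiction)
  open import Relation.Nullary.Decidable using (dec-true)
  open import Relation.Binary.PropositionalEquality
  open import Function using (_∘_)
  import Data.Fin.Properties as Fin
  open import Algebra.Properties.Semiring.Sum +-*-semiring using (sum; ∑-distrib-+; *-distribˡ-sum; sum-cong-≗)
  open WeightedCounting
  open Packings

  rows : ∀ {n} → (Fin n → Bool) → List (Vec Bool n)
  rows {zero}  R = [] ∷ []
  rows {suc n} R with R zero
  ... | true  = map (true ∷_) (rows (R ∘ suc))
  ... | false = map (true ∷_) (rows (R ∘ suc)) ++ map (false ∷_) (rows (R ∘ suc))

  -- Each forced entry halves the number of vectors.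
  length-rows : ∀ {n} (R : Fin n → Bool) → length (rows R) * 2 ^ card R ≡ 2 ^ n
  length-rows {zero}  R = refl
  length-rows {suc n} R with R zero
  ... | true  = begin
    length (map (true ∷_) rs) * (2 * 2 ^ card (R ∘ suc)) ≡⟨ cong (_* (2 * 2 ^ card (R ∘ suc))) (length-map (true ∷_) rs) ⟩
    length rs * (2 * 2 ^ card (R ∘ suc))                 ≡⟨ swap (length rs) 2 _ ⟩
    2 * (length rs * 2 ^ card (R ∘ suc))                 ≡⟨ cong (2 *_) (length-rows (R ∘ suc)) ⟩
    2 ^ suc n                                            ∎
    where
    open ≡-Reasoning
    rs : List (Vec Bool n)
    rs = rows (R ∘ suc)
    swap : ∀ a b c → a * (b * c) ≡ b * (a * c)
    swap = solve-∀
  ... | false = begin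
    length (map (true ∷_) rs ++ map (false ∷_) rs) * 2 ^ card (R ∘ suc)
      ≡⟨ cong (_* 2 ^ card (R ∘ suc)) (trans (length-++ (map (true ∷_) rs))
           (cong₂ _+_ (length-map (true ∷_) rs) (length-map (false ∷_) rs))) ⟩
    (length rs + length rs) * 2 ^ card (R ∘ suc) ≡⟨ double (length rs) _ ⟩
    2 * (length rs * 2 ^ card (R ∘ suc))         ≡⟨ cong (2 *_) (length-rows (R ∘ suc)) ⟩
    2 ^ suc n                                    ∎
    where
    open ≡-Reasoning
    rs : List (Vec Bool n)
    rs = rows (R ∘ suc)
    double : ∀ a c → (a + a) * c ≡ 2 * (a * c)
    double = solve-∀

  ∈-rows : ∀ {n} (R : Fin n → Bool) v → (∀ j → R j ≡ true → lookup v j ≡ true) → v LM.∈ rows R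
  ∈-rows R []      R⊆v = here refl
  ∈-rows R (b ∷ v) R⊆v with R zero in eq | ∈-rows (R ∘ suc) v (R⊆v ∘ suc)
  ... | true  | v∈ = subst (λ b → (b ∷ v) LM.∈ _) (sym (R⊆v zero eq)) (∈-map⁺ (true ∷_) v∈)
  ... | false | v∈ with b
  ... | true  = ∈-++⁺ˡ (∈-map⁺ (true ∷_) v∈)
  ... | false = ∈-++⁺ʳ _ (∈-map⁺ (false ∷_) v∈)

  length-cartesianProductWith : ∀ {A B C : Set} (f : A → B → C) xs ys →
                                length (cartesianProductWith f xs ys) ≡ length xs * length ys
  length-cartesianProductWith f []       ys = refl
  length-cartesianProductWith f (x ∷ xs) ys =
    trans (length-++ (map (f x) ys)) (cong₂ _+_ (length-map (f x) ys) (length-cartesianProductWith f xs ys))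

  matrices : ∀ {p n} → (Fin p → Fin n → Bool) → List (Vec (Vec Bool n) p)
  matrices {zero}  R = [] ∷ []
  matrices {suc p} R = cartesianProductWith _∷_ (rows (R zero)) (matrices (R ∘ suc))

  length-matrices : ∀ {p n} (R : Fin p → Fin n → Bool) →
                    length (matrices R) * 2 ^ sum (card ∘ R) ≡ 2 ^ (p * n)
  length-matrices {zero}      R = refl
  length-matrices {suc p} {n} R = begin
    length (matrices R) * 2 ^ (card (R zero) + s)
      ≡⟨ cong₂ _*_ (length-cartesianProductWith _∷_ (rows (R zero)) (matrices (R ∘ suc))) (^-distribˡ-+-* 2 (card (R zero)) s) ⟩
    length (rows (R zero)) * length (matrices (R ∘ suc)) * (2 ^ card (R zero) * 2 ^ s)
      ≡⟨ interchange (length (rows (R zero))) (length (matrices (R ∘ suc))) (2 ^ card (R zero)) (2 ^ s) ⟩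
    length (rows (R zero)) * 2 ^ card (R zero) * (length (matrices (R ∘ suc)) * 2 ^ s)
      ≡⟨ cong₂ _*_ (length-rows (R zero)) (length-matrices (R ∘ suc)) ⟩
    2 ^ n * 2 ^ (p * n)
      ≡⟨ sym (^-distribˡ-+-* 2 n (p * n)) ⟩
    2 ^ (suc p * n) ∎
    where
    open ≡-Reasoning
    s : ℕ
    s = sum (card ∘ R ∘ suc)
    interchange : ∀ a b c e → a * b * (c * e) ≡ a * c * (b * e)
    interchange = solve-∀

  ∈-matrices : ∀ {p n} (R : Fin p → Fin n → Bool) g →
               (∀ i j → R i j ≡ true → lookup (lookup g i) j ≡ true) → g LM.∈ matrices R
  ∈-matrices R []      R⊆g = here refl
  ∈-matrices R (v ∷ g) R⊆g =
    ∈-cartesianProductWith⁺ _∷_ (∈-rows (R zero) v (R⊆g zero)) (∈-matrices (R ∘ suc) g (R⊆g ∘ suc))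

  concatₛ : ∀ {A : Set} n → (Subset n → List A) → List A
  concatₛ zero    f = f []
  concatₛ (suc n) f = concatₛ n (f ∘ (true ∷_)) ++ concatₛ n (f ∘ (false ∷_))

  length-concatₛ : ∀ {A : Set} n (f : Subset n → List A) → length (concatₛ n f) ≡ ∑ₛ n (length ∘ f)
  length-concatₛ zero    f = refl
  length-concatₛ (suc n) f = trans (length-++ (concatₛ n (f ∘ (true ∷_))))
    (cong₂ _+_ (length-concatₛ n (f ∘ (true ∷_))) (length-concatₛ n (f ∘ (false ∷_))))

  ∈-concatₛ : ∀ {A : Set} {n} (f : Subset n → List A) S {a} → a LM.∈ f S → a LM.∈ concatₛ n f
  ∈-concatₛ f []          a∈ = a∈
  ∈-concatₛ f (true ∷ S)  a∈ = ∈-++⁺ˡ (∈-concatₛ (f ∘ (true ∷_)) S a∈)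
  ∈-concatₛ f (false ∷ S) a∈ = ∈-++⁺ʳ _ (∈-concatₛ (f ∘ (false ∷_)) S a∈)

  required : ∀ {n} → List (Subset n) → Fin n → Fin n → Bool
  required H i j = (toℕ i <ᵇ toℕ j) ∧ not (codegree H i j ≡ᵇ 0)

  orderedPair : ∀ {n} → Subset n → Fin n → Fin n → ℕ
  orderedPair S i j = ι (toℕ i <ᵇ toℕ j) * (ι (lookup S i) * ι (lookup S j))

  -- Pascal's rule: the first vertex, if present, is paired with each of the later members.
  pairs≡sizeC2 : ∀ {n} (S : Subset n) → sum (λ i → sum (orderedPair S i)) ≡ size S C 2
  pairs≡sizeC2 []      = refl
  pairs≡sizeC2 {suc n} (b ∷ S) = begin
    sum (λ j → 1 * (ι b * ι (lookup S j))) + sum (λ i → sum (orderedPair S i))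
      ≡⟨ cong₂ _+_ firstRow (pairs≡sizeC2 S) ⟩
    ι b * size S + size S C 2
      ≡⟨ pascal b ⟩
    size (b ∷ S) C 2 ∎
    where
    open ≡-Reasoning
    arrange : ∀ a c → 1 * (a * c) ≡ a * (c * 1)
    arrange = solve-∀
    firstRow : sum (λ j → 1 * (ι b * ι (lookup S j))) ≡ ι b * size S
    firstRow = trans (sum-cong-≗ (λ j → arrange (ι b) (ι (lookup S j))))
                     (sym (*-distribˡ-sum (ι b) (λ j → ι (lookup S j) * 1)))
    pascal : ∀ b → ι b * size S + size S C 2 ≡ (ι b * 1 + size S) C 2
    pascal true  = trans (cong (_+ size S C 2) (trans (*-identityˡ _) (sym (nC1≡n (size S)))))
                         (nCk+nC[k+1]≡[n+1]C[k+1] (size S) 1)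
    pascal false = refl

  distinct-< : ∀ {n} (i j : Fin n) → (toℕ i <ᵇ toℕ j) ≡ true → distinct i j ≡ 1
  distinct-< i j i<j with i Fin.≟ j
  ... | no _     = refl
  ... | yes refl = contradiction (<ᵇ⇒< (toℕ i) (toℕ i) (≡true⇒T i<j)) (<-irrefl refl)

  -- By independence no pair of S was required before, so the entries forced by S come on top of
  -- those forced by H.
  required-∷ : ∀ {n} (S : Subset n) H → Independent (codegree H) S → ∀ i j →
               orderedPair S i j + ι (required H i j) ≤ ι (required (S ∷ H) i j)
  required-∷ S H indep i j with toℕ i <ᵇ toℕ j in i<j
  ... | false = z≤n
  ... | true with lookup S i in i∈S | lookup S j in j∈S
  ... | false | _     = ≤-refl
  ... | true  | false = ≤-refl
  ... | true  | true  rewrite indep i j i∈S j∈S | distinct-< i j i<j = ≤-refl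

  -- Edge-disjoint blocks force different entries. This is the source of the factor 2^(-C(k, 2)) per
  -- block in the probability.
  count-required : ∀ {n k} {H : List (Subset n)} → Packing k H → length H * (k C 2) ≤ sum (card ∘ required H)
  count-required [] = z≤n
  count-required {n} {k} (_∷_ {S} {H} (size≡k , _ , indep) P) = begin
    k C 2 + length H * (k C 2)
      ≤⟨ +-mono-≤ (≤-reflexive (trans (cong (_C 2) (sym size≡k)) (sym (pairs≡sizeC2 S)))) (count-required P) ⟩
    sum (λ i → sum (orderedPair S i)) + sum (card ∘ required H)
      ≡⟨ sym (∑-distrib-+ (λ i → sum (orderedPair S i)) (card ∘ required H)) ⟩
    sum (λ i → sum (orderedPair S i) + card (required H i))
      ≡⟨ sum-cong-≗ (λ i → sym (∑-distrib-+ (orderedPair S i) (ι ∘ required H i))) ⟩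
    sum (λ i → sum (λ j → orderedPair S i j + ι (required H i j)))
      ≤⟨ sum-mono (λ i → sum-mono (required-∷ S H indep i)) ⟩
    sum (card ∘ required (S ∷ H)) ∎
    where open ≤-Reasoning

  -- The union bound as an enumeration: a table is repeated for every ordered way of extending H by
  -- m admissible blocks that are cliques in it, so the length of the list bounds the number of
  -- tables in question.
  tables : ∀ {n} → ℕ → ℕ → List (Subset n) → List (Table n)
  tables         k zero    H = matrices (required H)
  tables {n} k (suc m) H =
    concatₛ n (λ S → if does (admissible? (codegree H) everything k S) then tables k m (S ∷ H) else [])

  module _ {n k : ℕ} (B t e h M : ℕ) .{{_ : NonZero B}} .{{t≢0 : NonZero t}} .{{e≢0 : NonZero e}}
           (few : B * (M * t) ≤ n * e) (wide : n ≤ h * (t * e)) where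

    private instance
      te≢0 : NonZero (t * e)
      te≢0 = m*n≢0 t e {{t≢0}} {{e≢0}}

    -- In quotient form, a further block costs (2 n)^k B^h / (k! B^k 2^(C(k, 2))), and one factor
    -- B^potential pays for all light incidences still to come. M bounds the final number of blocks,
    -- so `few` gives sparsity at every stage.
    length-tables : ∀ m (H : List (Subset n)) → Packing k H → length H + m ≤ M →
      length (tables k m H) * (2 ^ (k C 2)) ^ (length H + m) * (k ! * B ^ k) ^ m
        ≤ 2 ^ (n * n) * ((2 * n) ^ k * B ^ h) ^ m * B ^ potential (2 * e) H
    length-tables zero H P _ = begin
      length (tables k 0 H) * (2 ^ (k C 2)) ^ (length H + 0) * 1
        ≡⟨ *-identityʳ _ ⟩
      length (tables k 0 H) * (2 ^ (k C 2)) ^ (length H + 0)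
        ≡⟨ cong (length (tables k 0 H) *_) (trans (^-*-assoc 2 (k C 2) (length H + 0))
             (cong (2 ^_) (trans (*-comm (k C 2) _) (cong (_* (k C 2)) (+-identityʳ (length H)))))) ⟩
      length (tables k 0 H) * 2 ^ (length H * (k C 2))
        ≤⟨ *-monoʳ-≤ (length (tables k 0 H)) (^-monoʳ-≤ 2 (count-required P)) ⟩
      length (tables k 0 H) * 2 ^ sum (card ∘ required H)
        ≡⟨ length-matrices (required H) ⟩
      2 ^ (n * n)
        ≡⟨ sym (*-identityʳ _) ⟩
      2 ^ (n * n) * 1
        ≤⟨ m≤m*n (2 ^ (n * n) * 1) (B ^ potential (2 * e) H) {{m^n≢0 B (potential (2 * e) H)}} ⟩
      2 ^ (n * n) * 1 * B ^ potential (2 * e) H ∎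
      where open ≤-Reasoning
    length-tables (suc m) H P ∣H∣≤M = begin
      length (tables k (suc m) H) * X * (k ! * B ^ k * Z)
        ≡⟨ cong (λ ℓ → ℓ * X * (k ! * B ^ k * Z)) (length-concatₛ n branch) ⟩
      ∑ₛ n (length ∘ branch) * X * (k ! * B ^ k * Z)
        ≡⟨ arrange (∑ₛ n (length ∘ branch)) X (k !) (B ^ k) Z ⟩
      k ! * (X * B ^ k * Z * ∑ₛ n (length ∘ branch))
        ≡⟨ cong (k ! *_) (*-distribˡ-∑ₛ n (X * B ^ k * Z) (length ∘ branch)) ⟩
      k ! * ∑ₛ n (λ S → X * B ^ k * Z * length (branch S))
        ≤⟨ *-monoʳ-≤ (k !) (∑ₛ-mono n extend) ⟩
      k ! * ∑ₛ n (λ S → W * F everything k S)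
        ≡⟨ cong (k ! *_) (sym (*-distribˡ-∑ₛ n W (F everything k))) ⟩
      k ! * (W * ∑ₛ n (F everything k))
        ≡⟨ swap (k !) W _ ⟩
      W * (k ! * ∑ₛ n (F everything k))
        ≤⟨ *-monoʳ-≤ W (∑F≤ (low-sparse B t e P few′) k h everything n≤) ⟩
      2 ^ (n * n) * Y * B ^ potential (2 * e) H * ((2 * n) ^ k * B ^ h)
        ≡⟨ collect (2 ^ (n * n)) Y (B ^ potential (2 * e) H) ((2 * n) ^ k * B ^ h) ⟩
      2 ^ (n * n) * ((2 * n) ^ k * B ^ h * Y) * B ^ potential (2 * e) H ∎
      where
      open ≤-Reasoning
      open WeightedCount B (t * e) (codegree H) (heavy (2 * e) H)
      branch : Subset n → List (Table n)
      branch S = if does (admissible? (codegree H) everything k S) then tables k m (S ∷ H) else []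
      X Y Z W : ℕ
      X = (2 ^ (k C 2)) ^ (length H + suc m)
      Y = ((2 * n) ^ k * B ^ h) ^ m
      Z = (k ! * B ^ k) ^ m
      W = 2 ^ (n * n) * Y * B ^ potential (2 * e) H
      arrange : ∀ s x f b z → s * x * (f * b * z) ≡ f * (x * b * z * s)
      arrange = solve-∀
      swap : ∀ a b c → a * (b * c) ≡ b * (a * c)
      swap = solve-∀
      collect : ∀ a y p q → a * y * p * q ≡ a * (q * y) * p
      collect = solve-∀
      few′ : B * (length H * t) ≤ n * e
      few′ = ≤-trans (*-monoʳ-≤ B (*-monoˡ-≤ t (≤-trans (m≤m+n (length H) (suc m)) ∣H∣≤M))) few
      n≤ : card {n} everything ≤ h * (t * e)
      n≤ = ≤-trans (≤-reflexive (trans (sum-const n 1) (*-identityʳ n))) wide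
      -- B^k times B^potential after the block equals B^mass times B^potential before it, so the sum
      -- over S becomes the weighted count.
      extend : ∀ S → X * B ^ k * Z * length (branch S) ≤ W * F everything k S
      extend S with admissible? (codegree H) everything k S
      ... | no _ = ≤-trans (≤-reflexive (*-zeroʳ (X * B ^ k * Z))) z≤n
      ... | yes adm@(size≡k , _) = begin
        X * B ^ k * Z * ℓ
          ≡⟨ cong (λ x → (2 ^ (k C 2)) ^ x * B ^ k * Z * ℓ) (+-suc (length H) m) ⟩
        (2 ^ (k C 2)) ^ (length (S ∷ H) + m) * B ^ k * Z * ℓ
          ≡⟨ regroup ((2 ^ (k C 2)) ^ (length (S ∷ H) + m)) (B ^ k) Z ℓ ⟩
        ℓ * (2 ^ (k C 2)) ^ (length (S ∷ H) + m) * Z * B ^ k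
          ≤⟨ *-monoˡ-≤ (B ^ k) (length-tables m (S ∷ H) (adm ∷ P)
               (≤-trans (≤-reflexive (sym (+-suc (length H) m))) ∣H∣≤M)) ⟩
        2 ^ (n * n) * Y * B ^ potential (2 * e) (S ∷ H) * B ^ k
          ≡⟨ trans (*-assoc (2 ^ (n * n) * Y) _ (B ^ k)) (cong (2 ^ (n * n) * Y *_) powers) ⟩
        2 ^ (n * n) * Y * (B ^ potential (2 * e) H * B ^ mass S)
          ≡⟨ sym (*-assoc (2 ^ (n * n) * Y) _ (B ^ mass S)) ⟩
        W * B ^ mass S
          ≡⟨ cong (W *_) (sym (*-identityˡ _)) ⟩
        W * (1 * B ^ mass S) ∎
        where
        ℓ : ℕ
        ℓ = length (tables k m (S ∷ H))
        regroup : ∀ x b z l → x * b * z * l ≡ l * x * z * b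
        regroup = solve-∀
        powers : B ^ potential (2 * e) (S ∷ H) * B ^ k ≡ B ^ potential (2 * e) H * B ^ mass S
        powers = begin-equality
          B ^ potential (2 * e) (S ∷ H) * B ^ k
            ≡⟨ cong (λ z → B ^ potential (2 * e) (S ∷ H) * B ^ z) (sym size≡k) ⟩
          B ^ potential (2 * e) (S ∷ H) * B ^ size S
            ≡⟨ sym (^-distribˡ-+-* B (potential (2 * e) (S ∷ H)) (size S)) ⟩
          B ^ (potential (2 * e) (S ∷ H) + size S)
            ≡⟨ cong (B ^_) (potential-∷ (2 * e) S H) ⟩
          B ^ (potential (2 * e) H + mass S)
            ≡⟨ ^-distribˡ-+-* B (potential (2 * e) H) (mass S) ⟩
          B ^ potential (2 * e) H * B ^ mass S ∎

  size≡∣∣ : ∀ {n} (S : Subset n) → size S ≡ ∣ S ∣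
  size≡∣∣ []          = refl
  size≡∣∣ (true ∷ S)  = cong suc (size≡∣∣ S)
  size≡∣∣ (false ∷ S) = size≡∣∣ S

  codegree-∷-zero : ∀ {n} (S : Subset n) H x y → codegree H x y ≡ 0 →
    (x ≢ y → lookup S x ≡ true → lookup S y ≡ true → ⊥) → codegree (S ∷ H) x y ≡ 0
  codegree-∷-zero S H x y c≡0 apart with x Fin.≟ y
  ... | yes _ = trans (cong (_+ codegree H x y) (*-zeroʳ (ι (lookup S x) * ι (lookup S y)))) c≡0
  ... | no x≢y with lookup S x in x∈S | lookup S y in y∈S
  ... | false | _     = c≡0
  ... | true  | false = c≡0
  ... | true  | true  = ⊥-elim (apart x≢y refl refl)

  -- Generalised to a partial packing H: g already has the edges of H, and the remaining cliques
  -- avoid its pairs. Both properties pass to `S ∷ H`, the second because S is edge-disjoint from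
  -- the later cliques.
  ∈-tables : ∀ {n} (g : Table n) k m H →
    (∀ i j → required H i j ≡ true → lookup (lookup g i) j ≡ true) →
    (𝓕 : Fin m → Subset n) →
    (∀ a → IsClique g k (𝓕 a)) → (∀ a → Independent (codegree H) (𝓕 a)) →
    (∀ a b → a ≢ b → EdgeDisjoint (𝓕 a) (𝓕 b)) →
    g LM.∈ tables k m H
  ∈-tables g k zero    H present 𝓕 cliques indep disjoint = ∈-matrices (required H) g present
  ∈-tables {n} g k (suc m) H present 𝓕 cliques indep disjoint =
    ∈-concatₛ branch S (subst (λ b → g LM.∈ (if b then tables k m (S ∷ H) else []))
      (sym (dec-true (admissible? (codegree H) everything k S)
                     (trans (size≡∣∣ S) (proj₁ (cliques zero)) , (λ _ _ → refl) , indep zero)))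
      (∈-tables g k m (S ∷ H) present′ (𝓕 ∘ suc) (cliques ∘ suc) indep′
        (λ a b a≢b → disjoint (suc a) (suc b) (a≢b ∘ Fin.suc-injective))))
    where
    S : Subset n
    S = 𝓕 zero
    branch : Subset n → List (Table n)
    branch S = if does (admissible? (codegree H) everything k S) then tables k m (S ∷ H) else []
    indep′ : ∀ a → Independent (codegree (S ∷ H)) (𝓕 (suc a))
    indep′ a x y x∈ y∈ = codegree-∷-zero S H x y (indep (suc a) x y x∈ y∈) λ x≢y x∈S y∈S →
      disjoint zero (suc a) Fin.0≢1+n x y x≢y (lookup⇒[]= x S x∈S) (lookup⇒[]= y S y∈S)
        (lookup⇒[]= x (𝓕 (suc a)) x∈) (lookup⇒[]= y (𝓕 (suc a)) y∈)
    edge : ∀ i j → (toℕ i <ᵇ toℕ j) ≡ true → lookup S i ≡ true → lookup S j ≡ true → lookup (lookup g i) j ≡ true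
    edge i j i<j i∈S j∈S with i<j′ ← <ᵇ⇒< (toℕ i) (toℕ j) (≡true⇒T i<j)
      with proj₂ (cliques zero) i j (λ { refl → <-irrefl refl i<j′ }) (lookup⇒[]= i S i∈S) (lookup⇒[]= j S j∈S)
    ... | inj₁ (_ , ij∈g) = T⇒≡true ij∈g
    ... | inj₂ (j<i , _)  = contradiction j<i (<-asym i<j′)
    present′ : ∀ i j → required (S ∷ H) i j ≡ true → lookup (lookup g i) j ≡ true
    present′ i j req with toℕ i <ᵇ toℕ j in i<j | lookup S i in i∈S | lookup S j in j∈S | present i j
    ... | true | false | _     | old = old req
    ... | true | true  | false | old = old req
    ... | true | true  | true  | _   = edge i j i<j i∈S j∈S

-- A rational upper bound for the exponential series

module ExponentialBound where
  open import Data.Nat using (ℕ; zero; suc; NonZero)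
  import Data.Nat as ℕ
  import Data.Nat.Properties as ℕ
  open import Data.Nat.Combinatorics using (_C_)
  open import Data.Nat.Base using (_!)
  open import Data.Nat.Tactic.RingSolver using (solve-∀)
  open import Data.Integer as ℤ using (ℤ; +_)
  import Data.Integer.Properties as ℤ
  import Data.Rational.Unnormalised as ℚᵘ
  import Data.Rational.Unnormalised.Properties as ℚᵘ
  open import Data.Rational hiding (NonZero)
  open import Data.Rational.Properties
  open import Relation.Binary.PropositionalEquality
  open Binomial

  toℚᵘ-/ : ∀ a b .{{_ : NonZero b}} → toℚᵘ (+ a / b) ℚᵘ.≃ (+ a ℚᵘ./ b)
  toℚᵘ-/ a (suc b) = toℚᵘ-fromℚᵘ (ℚᵘ.mkℚᵘ (+ a) b)

  /-mono : ∀ {a b c e} .{{_ : NonZero b}} .{{_ : NonZero e}} → a ℕ.* e ℕ.≤ c ℕ.* b → (+ a / b) ≤ (+ c / e)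
  /-mono {a} {suc b} {c} {suc e} le = toℚᵘ-cancel-≤
    (ℚᵘ.≤-respˡ-≃ (ℚᵘ.≃-sym (toℚᵘ-/ a (suc b))) (ℚᵘ.≤-respʳ-≃ (ℚᵘ.≃-sym (toℚᵘ-/ c (suc e)))
      (ℚᵘ.*≤* (subst₂ ℤ._≤_ (ℤ.pos-* a (suc e)) (ℤ.pos-* c (suc b)) (ℤ.+≤+ le)))))

  /-mono-< : ∀ {a b c e} .{{_ : NonZero b}} .{{_ : NonZero e}} → a ℕ.* e ℕ.< c ℕ.* b → (+ a / b) < (+ c / e)
  /-mono-< {a} {suc b} {c} {suc e} lt = toℚᵘ-cancel-<
    (ℚᵘ.<-respˡ-≃ (ℚᵘ.≃-sym (toℚᵘ-/ a (suc b))) (ℚᵘ.<-respʳ-≃ (ℚᵘ.≃-sym (toℚᵘ-/ c (suc e)))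
      (ℚᵘ.*<* (subst₂ ℤ._<_ (ℤ.pos-* a (suc e)) (ℤ.pos-* c (suc b)) (ℤ.+<+ lt)))))

  /-* : ∀ a b c e .{{_ : NonZero b}} .{{_ : NonZero e}} →
        (+ a / b) * (+ c / e) ≡ (+ (a ℕ.* c) / (b ℕ.* e)) {{ℕ.m*n≢0 b e}}
  /-* a (suc b) c (suc e) = toℚᵘ-injective (begin
    toℚᵘ ((+ a / suc b) * (+ c / suc e))                 ≈⟨ toℚᵘ-homo-* (+ a / suc b) (+ c / suc e) ⟩
    toℚᵘ (+ a / suc b) ℚᵘ.* toℚᵘ (+ c / suc e)           ≈⟨ ℚᵘ.*-cong (toℚᵘ-/ a (suc b)) (toℚᵘ-/ c (suc e)) ⟩
    ℚᵘ.mkℚᵘ (+ a ℤ.* + c) (e ℕ.+ b ℕ.* suc e)            ≡⟨ cong (λ z → ℚᵘ.mkℚᵘ z (e ℕ.+ b ℕ.* suc e)) (sym (ℤ.pos-* a c)) ⟩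
    ℚᵘ.mkℚᵘ (+ (a ℕ.* c)) (e ℕ.+ b ℕ.* suc e)            ≈⟨ ℚᵘ.≃-sym (toℚᵘ-/ (a ℕ.* c) (suc b ℕ.* suc e)) ⟩
    toℚᵘ (+ (a ℕ.* c) / (suc b ℕ.* suc e))               ∎)
    where open import Relation.Binary.Reasoning.Setoid ℚᵘ.≃-setoid

  *-mono-≤-nonNeg : ∀ {p q r s} .{{_ : NonNegative p}} .{{_ : NonNegative s}} → p ≤ q → r ≤ s → p * r ≤ q * s
  *-mono-≤-nonNeg {p} {q} {r} {s} p≤q r≤s = ≤-trans (*-monoˡ-≤-nonNeg p r≤s) (*-monoʳ-≤-nonNeg s p≤q)

  /-nonNeg : ∀ a b .{{_ : NonZero b}} → NonNegative (+ a / b)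
  /-nonNeg a b = normalize-nonNeg a b

  expTerm-nonNeg : ∀ x .{{_ : NonNegative x}} i → NonNegative (expTerm x i)
  expTerm-nonNeg x zero    = _
  expTerm-nonNeg x {{x≥0}} (suc i) =
    nonNeg*nonNeg⇒nonNeg (expTerm x i * x)
      {{nonNeg*nonNeg⇒nonNeg (expTerm x i) {{expTerm-nonNeg x {{x≥0}} i}} x {{x≥0}}}}
      (+ 1 / suc i) {{/-nonNeg 1 (suc i)}}

  infix 8 _^/_!
  _^/_! : ℕ → ℕ → ℚ
  N ^/ i ! = (+ (N ℕ.^ i) / (i !)) {{i ℕ.!≢0}}

  expTerm≤ : ∀ x .{{_ : NonNegative x}} N → x ≤ + N / 1 → ∀ i → expTerm x i ≤ N ^/ i !
  expTerm≤ x N x≤N zero    = ≤-refl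
  expTerm≤ x {{x≥0}} N x≤N (suc i) = begin
    expTerm x i * x * (+ 1 / suc i)
      ≤⟨ *-monoʳ-≤-nonNeg (+ 1 / suc i) {{/-nonNeg 1 (suc i)}}
           (*-mono-≤-nonNeg {{expTerm-nonNeg x {{x≥0}} i}} {{/-nonNeg N 1}} (expTerm≤ x {{x≥0}} N x≤N i) x≤N) ⟩
    N ^/ i ! * (+ N / 1) * (+ 1 / suc i)
      ≡⟨ cong (_* (+ 1 / suc i)) (/-* (N ℕ.^ i) (i !) N 1) ⟩
    (+ (N ℕ.^ i ℕ.* N) / (i ! ℕ.* 1)) * (+ 1 / suc i)
      ≡⟨ /-* (N ℕ.^ i ℕ.* N) (i ! ℕ.* 1) 1 (suc i) ⟩
    + (N ℕ.^ i ℕ.* N ℕ.* 1) / (i ! ℕ.* 1 ℕ.* suc i)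
      ≤⟨ /-mono {N ℕ.^ i ℕ.* N ℕ.* 1} {i ! ℕ.* 1 ℕ.* suc i} {N ℕ.^ suc i} {suc i !}
           (ℕ.≤-reflexive (shuffle N (N ℕ.^ i) (i !) (suc i))) ⟩
    N ^/ suc i ! ∎
    where
    open ≤-Reasoning
    instance
      i!≢0 : NonZero (i !)
      i!≢0 = i ℕ.!≢0
      i!1≢0 : NonZero (i ! ℕ.* 1)
      i!1≢0 = ℕ.m*n≢0 (i !) 1 {{i ℕ.!≢0}}
      i!1i≢0 : NonZero (i ! ℕ.* 1 ℕ.* suc i)
      i!1i≢0 = ℕ.m*n≢0 (i ! ℕ.* 1) (suc i) {{i!1≢0}}
      si!≢0 : NonZero (suc i !)
      si!≢0 = suc i ℕ.!≢0
    shuffle : ∀ n p f s → p ℕ.* n ℕ.* 1 ℕ.* (s ℕ.* f) ≡ n ℕ.* p ℕ.* (f ℕ.* 1 ℕ.* s)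
    shuffle = solve-∀

  -- The factor 4 in (4 N) ^ i ≤ i ! * 2 ^ (4 N + i) leaves a geometrically decaying bound.
  N^i*2^i≤16^N*i! : ∀ N i → N ℕ.^ i ℕ.* 2 ℕ.^ i ℕ.≤ 2 ℕ.^ (4 ℕ.* N) ℕ.* i !
  N^i*2^i≤16^N*i! N i = ℕ.*-cancelʳ-≤ _ _ (2 ℕ.^ i) {{ℕ.m^n≢0 2 i}} (begin
    N ℕ.^ i ℕ.* 2 ℕ.^ i ℕ.* 2 ℕ.^ i       ≡⟨ ℕ.*-assoc (N ℕ.^ i) (2 ℕ.^ i) (2 ℕ.^ i) ⟩
    N ℕ.^ i ℕ.* (2 ℕ.^ i ℕ.* 2 ℕ.^ i)     ≡⟨ cong (N ℕ.^ i ℕ.*_) (sym (^-distribʳ-* i 2 2)) ⟩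
    N ℕ.^ i ℕ.* 4 ℕ.^ i                   ≡⟨ sym (^-distribʳ-* i N 4) ⟩
    (N ℕ.* 4) ℕ.^ i                       ≡⟨ cong (ℕ._^ i) (ℕ.*-comm N 4) ⟩
    (4 ℕ.* N) ℕ.^ i                       ≤⟨ m^i≤i!*[m+i]Ci (4 ℕ.* N) i ⟩
    i ! ℕ.* ((4 ℕ.* N ℕ.+ i) C i)         ≤⟨ ℕ.*-monoʳ-≤ (i !) (nCk≤2^n (4 ℕ.* N ℕ.+ i) i) ⟩
    i ! ℕ.* 2 ℕ.^ (4 ℕ.* N ℕ.+ i)         ≡⟨ cong (i ! ℕ.*_) (ℕ.^-distribˡ-+-* 2 (4 ℕ.* N) i) ⟩
    i ! ℕ.* (2 ℕ.^ (4 ℕ.* N) ℕ.* 2 ℕ.^ i) ≡⟨ shuffle (i !) (2 ℕ.^ (4 ℕ.* N)) (2 ℕ.^ i) ⟩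
    2 ℕ.^ (4 ℕ.* N) ℕ.* i ! ℕ.* 2 ℕ.^ i   ∎)
    where
    open ℕ.≤-Reasoning
    shuffle : ∀ a b c → a ℕ.* (b ℕ.* c) ≡ b ℕ.* a ℕ.* c
    shuffle = solve-∀

  /-+ : ∀ a b c e .{{_ : NonZero b}} .{{_ : NonZero e}} →
        (+ a / b) + (+ c / e) ≡ (+ (a ℕ.* e ℕ.+ c ℕ.* b) / (b ℕ.* e)) {{ℕ.m*n≢0 b e}}
  /-+ a (suc b) c (suc e) = toℚᵘ-injective (begin
    toℚᵘ ((+ a / suc b) + (+ c / suc e))
      ≈⟨ toℚᵘ-homo-+ (+ a / suc b) (+ c / suc e) ⟩
    toℚᵘ (+ a / suc b) ℚᵘ.+ toℚᵘ (+ c / suc e)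
      ≈⟨ ℚᵘ.+-cong (toℚᵘ-/ a (suc b)) (toℚᵘ-/ c (suc e)) ⟩
    ℚᵘ.mkℚᵘ (+ a ℤ.* + suc e ℤ.+ + c ℤ.* + suc b) (e ℕ.+ b ℕ.* suc e)
      ≡⟨ cong (λ z → ℚᵘ.mkℚᵘ z (e ℕ.+ b ℕ.* suc e)) (sym (cong₂ ℤ._+_ (ℤ.pos-* a (suc e)) (ℤ.pos-* c (suc b)))) ⟩
    ℚᵘ.mkℚᵘ (+ (a ℕ.* suc e ℕ.+ c ℕ.* suc b)) (e ℕ.+ b ℕ.* suc e)
      ≈⟨ ℚᵘ.≃-sym (toℚᵘ-/ (a ℕ.* suc e ℕ.+ c ℕ.* suc b) (suc b ℕ.* suc e)) ⟩
    toℚᵘ (+ (a ℕ.* suc e ℕ.+ c ℕ.* suc b) / (suc b ℕ.* suc e)) ∎)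
    where open import Relation.Binary.Reasoning.Setoid ℚᵘ.≃-setoid

  infix 8 _/2^_
  _/2^_ : ℕ → ℕ → ℚ
  K /2^ i = (+ K / (2 ℕ.^ i)) {{ℕ.m^n≢0 2 i}}

  half+half : ∀ K i → K /2^ suc i + K /2^ suc i ≤ K /2^ i
  half+half K i = ≤-trans (≤-reflexive (/-+ K (2 ℕ.^ suc i) K (2 ℕ.^ suc i)))
    (/-mono {K ℕ.* (2 ℕ.* p) ℕ.+ K ℕ.* (2 ℕ.* p)} {2 ℕ.* p ℕ.* (2 ℕ.* p)} {K} {p} (ℕ.≤-reflexive (shuffle K p)))
    where
    p : ℕ
    p = 2 ℕ.^ i
    instance
      p≢0 : NonZero p
      p≢0 = ℕ.m^n≢0 2 i
      2p≢0 : NonZero (2 ℕ.^ suc i)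
      2p≢0 = ℕ.m^n≢0 2 (suc i)
      pp≢0 : NonZero (2 ℕ.^ suc i ℕ.* 2 ℕ.^ suc i)
      pp≢0 = ℕ.m*n≢0 (2 ℕ.^ suc i) (2 ℕ.^ suc i) {{2p≢0}} {{2p≢0}}
    shuffle : ∀ K p → (K ℕ.* (2 ℕ.* p) ℕ.+ K ℕ.* (2 ℕ.* p)) ℕ.* p ≡ K ℕ.* (2 ℕ.* p ℕ.* (2 ℕ.* p))
    shuffle = solve-∀

  -- Each term is at most K / 2^i with K = 16^N, so the partial sum plus the geometric tail 2 K /
  -- 2^m never exceeds 2 K. A base as crude as 16 in place of e suffices, since the union bound
  -- leaves a surplus of 2^(6 N).
  expPartial≤ : ∀ x .{{_ : NonNegative x}} N → x ≤ + N / 1 → ∀ m → expPartial x m ≤ + (2 ℕ.* 2 ℕ.^ (4 ℕ.* N)) / 1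
  expPartial≤ x {{x≥0}} N x≤N m = begin
    expPartial x m                        ≡⟨ sym (+-identityʳ (expPartial x m)) ⟩
    expPartial x m + 0ℚ
      ≤⟨ +-monoʳ-≤ (expPartial x m) (nonNegative⁻¹ (K /2^ m + K /2^ m)
           {{nonNeg+nonNeg⇒nonNeg (K /2^ m) {{v≥0 m}} (K /2^ m) {{v≥0 m}}}}) ⟩
    expPartial x m + (K /2^ m + K /2^ m)  ≤⟨ invariant m ⟩
    K /2^ 0 + K /2^ 0                     ≡⟨ /-+ K 1 K 1 ⟩
    + (K ℕ.* 1 ℕ.+ K ℕ.* 1) / 1           ≡⟨ cong (λ z → + z / 1) (double K) ⟩
    + (2 ℕ.* K) / 1                       ∎
    where
    open ≤-Reasoning
    K : ℕ
    K = 2 ℕ.^ (4 ℕ.* N)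
    double : ∀ K → K ℕ.* 1 ℕ.+ K ℕ.* 1 ≡ 2 ℕ.* K
    double = solve-∀
    v≥0 : ∀ i → NonNegative (K /2^ i)
    v≥0 i = /-nonNeg K (2 ℕ.^ i) {{ℕ.m^n≢0 2 i}}
    term≤ : ∀ i → expTerm x i ≤ K /2^ i
    term≤ i = ≤-trans (expTerm≤ x {{x≥0}} N x≤N i)
      (/-mono {N ℕ.^ i} {i !} {K} {2 ℕ.^ i} {{i ℕ.!≢0}} {{ℕ.m^n≢0 2 i}} (N^i*2^i≤16^N*i! N i))
    invariant : ∀ m → expPartial x m + (K /2^ m + K /2^ m) ≤ K /2^ 0 + K /2^ 0
    invariant zero    = ≤-reflexive (+-identityˡ _)
    invariant (suc m) = begin
      expPartial x m + expTerm x m + (K /2^ suc m + K /2^ suc m)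
        ≤⟨ +-mono-≤ (+-monoʳ-≤ (expPartial x m) (term≤ m)) (half+half K m) ⟩
      expPartial x m + K /2^ m + K /2^ m
        ≡⟨ +-assoc (expPartial x m) (K /2^ m) (K /2^ m) ⟩
      expPartial x m + (K /2^ m + K /2^ m)
        ≤⟨ invariant m ⟩
      K /2^ 0 + K /2^ 0 ∎

-- Choice of the parameters and the union bound

module TailBounds where
  open import Data.Nat
  open import Data.Nat.Properties
  open import Data.Nat.DivMod using (m/n*n≤m; m≡m%n+[m/n]*n; m%n<n; m≥n⇒m/n>0; m/n≤m)
  open import Data.Nat.Combinatorics using (_C_; nCk+nC[k+1]≡[n+1]C[k+1])
  open import Data.Nat.Tactic.RingSolver using (solve-∀)
  open import Data.Bool using (true; false)
  open import Data.Fin using (Fin; toℕ; inject≤)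
  open import Data.Fin.Properties using (inject≤-injective)
  open import Data.List using (List; []; length)
  import Data.List.Membership.Propositional as LM
  import Data.Integer as ℤ
  import Data.Integer.Properties as ℤ
  import Data.Rational as ℚ
  import Data.Rational.Properties as ℚ
  open import Data.Product using (∃; _,_; proj₂)
  open import Relation.Nullary using (contradiction)
  open import Relation.Binary.PropositionalEquality
  open import Function using (_∘_)
  open Binomial
  open WeightedCounting
  open Packings
  open CliqueTables
  open ExponentialBound

  m<[1+m/n]*n : ∀ m n .{{_ : NonZero n}} → m < suc (m / n) * n
  m<[1+m/n]*n m n = begin-strict
    m                   ≡⟨ m≡m%n+[m/n]*n m n ⟩
    m % n + m / n * n   <⟨ +-monoˡ-< (m / n * n) (m%n<n m n) ⟩
    suc (m / n) * n     ∎
    where open ≤-Reasoning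

  -- Here t is the slope of the tangent, 2 e the threshold of heaviness, h the number of shrinking
  -- choices per block and m the number of blocks. For a set L of n / B vertices of degree 2 e, the
  -- average size of L ∩ S over the blocks is 2 e n / (B m); `Bmt≤ne` keeps t below half of it.
  record Parameters (B n k : ℕ) : Set where
    field
      t e h m     : ℕ
      {{t≢0}}     : NonZero t
      {{e≢0}}     : NonZero e
      4h≤k        : 4 * h ≤ k
      t≤k         : t ≤ k
      n≤hte       : n ≤ h * (t * e)
      8en≤km      : 8 * (e * n) ≤ k * m
      Bmt≤ne      : B * (m * t) ≤ n * e
      mk³≤        : m * k ^ 3 ≤ 16 * (8 * (2 * (2 * (16 * B)))) * (n * n)

  abstract
    parameters : ∀ B n k .{{_ : NonZero B}} .{{_ : NonZero k}} → 16 * B ≤ k → k * k ≤ n → Parameters B n k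
    parameters B n k τ≤k kk≤n = record
      { t = t ; e = e ; h = h ; m = m ; t≢0 = t≢0
      ; 4h≤k = ≤-trans (≤-reflexive (*-comm 4 h)) (m/n*n≤m k 4)
      ; t≤k = m/n≤m k τ
      ; n≤hte = ≤-trans (<⇒≤ (m<[1+m/n]*n n (h * t))) (≤-reflexive (rotate e h t))
      ; 8en≤km = ≤-trans (<⇒≤ (m<[1+m/n]*n (8 * (e * n)) k)) (≤-reflexive (*-comm m k))
      ; Bmt≤ne = *-cancelˡ-≤ 16 (begin
          16 * (B * (m * t))  ≡⟨ arrange 16 B m t ⟩
          m * (t * (16 * B))  ≤⟨ *-monoʳ-≤ m (m/n*n≤m k τ) ⟩
          m * k               ≤⟨ mk≤ ⟩
          16 * (e * n)        ≡⟨ cong (16 *_) (*-comm e n) ⟩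
          16 * (n * e)        ∎)
      ; mk³≤ = begin
          m * k ^ 3                                       ≡⟨ cube m k ⟩
          m * k * (k * k)                                 ≤⟨ *-mono-≤ mk≤ (*-mono-≤ k≤8h k≤2tτ) ⟩
          16 * (e * n) * (8 * h * (2 * (t * τ)))          ≡⟨ gather 16 8 2 τ e n h t ⟩
          16 * (8 * (2 * (τ * (n * (e * (h * t))))))      ≤⟨ *-monoʳ-≤ 16 (*-monoʳ-≤ 8 (*-monoʳ-≤ 2 (*-monoʳ-≤ τ (*-monoʳ-≤ n eht≤2n)))) ⟩
          16 * (8 * (2 * (τ * (n * (2 * n)))))            ≡⟨ spread 16 8 2 τ n 2 ⟩
          16 * (8 * (2 * (2 * τ))) * (n * n)              ∎
      }
      where
      open ≤-Reasoning
      τ t h : ℕ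
      -- Rounding m up allows m k to grow from 8 e n to 16 e n; with t = k / (16 B) this still gives
      -- B m t ≤ m k / 16 ≤ e n.
      τ = 16 * B
      instance
        τ≢0 : NonZero τ
        τ≢0 = m*n≢0 16 B
      t = k / τ
      h = k / 4
      16≤k : 16 ≤ k
      16≤k = ≤-trans (m≤m*n 16 B) τ≤k
      t>0 : t > 0
      t>0 = m≥n⇒m/n>0 τ≤k
      h>0 : h > 0
      h>0 = m≥n⇒m/n>0 (≤-trans (m≤m+n 4 12) 16≤k)
      instance
        t≢0 : NonZero t
        t≢0 = >-nonZero t>0
        h≢0 : NonZero h
        h≢0 = >-nonZero h>0
        ht≢0 : NonZero (h * t)
        ht≢0 = m*n≢0 h t {{h≢0}} {{t≢0}}
      e m : ℕ
      -- The added units round up. As h t ≤ k² ≤ n and k ≤ 8 e n, they raise e h t to at most 2 n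
      -- and m k to at most 16 e n.
      e = suc (n / (h * t))
      m = suc (8 * (e * n) / k)
      rotate : ∀ e h t → e * (h * t) ≡ h * (t * e)
      rotate = solve-∀
      arrange : ∀ a b c d → a * (b * (c * d)) ≡ c * (d * (a * b))
      arrange = solve-∀
      cube : ∀ m k → m * (k * (k * (k * 1))) ≡ m * k * (k * k)
      cube = solve-∀
      gather : ∀ a b c τ e n h t → a * (e * n) * (b * h * (c * (t * τ))) ≡ a * (b * (c * (τ * (n * (e * (h * t))))))
      gather = solve-∀
      spread : ∀ a b c τ n d → a * (b * (c * (τ * (n * (d * n))))) ≡ a * (b * (c * (d * τ))) * (n * n)
      spread = solve-∀
      twice : ∀ x → x + x ≡ 2 * x
      twice = solve-∀
      k≤8h : k ≤ 8 * h
      k≤8h = begin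
        k             ≤⟨ <⇒≤ (m<[1+m/n]*n k 4) ⟩
        4 + h * 4     ≤⟨ +-mono-≤ (*-monoʳ-≤ 4 h>0) (≤-reflexive (*-comm h 4)) ⟩
        4 * h + 4 * h ≡⟨ sym (*-distribʳ-+ h 4 4) ⟩
        8 * h         ∎
      k≤2tτ : k ≤ 2 * (t * τ)
      k≤2tτ = begin
        k             ≤⟨ <⇒≤ (m<[1+m/n]*n k τ) ⟩
        τ + t * τ     ≤⟨ +-monoˡ-≤ (t * τ) (m≤n*m τ t) ⟩
        t * τ + t * τ ≡⟨ twice (t * τ) ⟩
        2 * (t * τ)   ∎
      eht≤2n : e * (h * t) ≤ 2 * n
      eht≤2n = begin
        h * t + n / (h * t) * (h * t) ≤⟨ +-mono-≤ (≤-trans (*-mono-≤ (m/n≤m k 4) (m/n≤m k τ)) kk≤n) (m/n*n≤m n (h * t)) ⟩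
        n + n                         ≡⟨ twice n ⟩
        2 * n                         ∎
      k≤8en : k ≤ 8 * (e * n)
      k≤8en = begin
        k           ≤⟨ m≤m*n k k ⟩
        k * k       ≤⟨ kk≤n ⟩
        n           ≤⟨ m≤n*m n e ⟩
        e * n       ≤⟨ m≤n*m (e * n) 8 ⟩
        8 * (e * n) ∎
      mk≤ : m * k ≤ 16 * (e * n)
      mk≤ = begin
        k + 8 * (e * n) / k * k         ≤⟨ +-mono-≤ k≤8en (m/n*n≤m (8 * (e * n)) k) ⟩
        8 * (e * n) + 8 * (e * n)       ≡⟨ sym (*-distribʳ-+ (e * n) 8 8) ⟩
        16 * (e * n)                    ∎

  -- The exponent leaves a surplus 2 ^ (6 * (k * m)), against exp (n² / k²) ≤ 2 ^ (1 + 4 * (k * m)).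
  root : ℕ → ℕ
  root c₁ = 2 ^ (c₁ + 8)

  module _ (c₁ n k m e h ℓ : ℕ)
           (2k≤n : 2 * k ≤ n) (4h≤k : 4 * h ≤ k) (8en≤km : 8 * (e * n) ≤ k * m)
           (nCk≤ : n C k ≤ 2 ^ (k C 2 + c₁ * k))
           (ℓ-bound : ℓ * (2 ^ (k C 2)) ^ m * (k ! * (root c₁ * root c₁) ^ k) ^ m
                      ≤ 2 ^ (n * n) * ((2 * n) ^ k * (root c₁ * root c₁) ^ h) ^ m * (root c₁ * root c₁) ^ (n * (2 * e))) where

    open ≤-Reasoning

    private
      b B : ℕ
      b = root c₁
      B = b * b

    private instance
      b≢0 : NonZero b
      b≢0 = m^n≢0 2 (c₁ + 8)

    -- Turns ordered choices back into C(n, k), and here f(k) ≤ 2^(c₁ k) enters. Of the additional 2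
    -- k in the exponent, one k comes from the factor 2 in 2 n and one from n^k ≤ 2^k k! C(n, k).
    [2n]^k≤ : (2 * n) ^ k ≤ 2 ^ (k C 2) * k ! * 2 ^ ((c₁ + 2) * k)
    [2n]^k≤ = begin
      (2 * n) ^ k                                          ≡⟨ ^-distribʳ-* k 2 n ⟩
      2 ^ k * n ^ k                                        ≤⟨ *-monoʳ-≤ (2 ^ k) (n^k≤2^k*k!*nCk n k 2k≤n) ⟩
      2 ^ k * (2 ^ k * (k ! * (n C k)))                    ≤⟨ *-monoʳ-≤ (2 ^ k) (*-monoʳ-≤ (2 ^ k) (*-monoʳ-≤ (k !) nCk≤)) ⟩
      2 ^ k * (2 ^ k * (k ! * 2 ^ (k C 2 + c₁ * k)))       ≡⟨ cong (λ z → 2 ^ k * (2 ^ k * (k ! * z))) (^-distribˡ-+-* 2 (k C 2) (c₁ * k)) ⟩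
      2 ^ k * (2 ^ k * (k ! * (2 ^ (k C 2) * 2 ^ (c₁ * k)))) ≡⟨ shuffle (2 ^ k) (k !) (2 ^ (k C 2)) (2 ^ (c₁ * k)) ⟩
      2 ^ (k C 2) * k ! * (2 ^ (c₁ * k) * (2 ^ k * 2 ^ k)) ≡⟨ cong (λ z → 2 ^ (k C 2) * k ! * (2 ^ (c₁ * k) * z)) (sym (^-distribˡ-+-* 2 k k)) ⟩
      2 ^ (k C 2) * k ! * (2 ^ (c₁ * k) * 2 ^ (k + k))     ≡⟨ cong (2 ^ (k C 2) * k ! *_) (sym (^-distribˡ-+-* 2 (c₁ * k) (k + k))) ⟩
      2 ^ (k C 2) * k ! * 2 ^ (c₁ * k + (k + k))           ≡⟨ cong (λ z → 2 ^ (k C 2) * k ! * 2 ^ z) (collect c₁ k) ⟩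
      2 ^ (k C 2) * k ! * 2 ^ ((c₁ + 2) * k)               ∎
      where
      shuffle : ∀ a f p q → a * (a * (f * (p * q))) ≡ p * f * (q * (a * a))
      shuffle = solve-∀
      collect : ∀ c k → c * k + (k + k) ≡ (c + 2) * k
      collect = solve-∀

    -- Each summand of the exponent is at most a quarter of k m. B is the square of b so that the
    -- resulting half disappears.
    B^≤b^ : B ^ (h * m + n * (2 * e)) ≤ b ^ (k * m)
    B^≤b^ = begin
      B ^ E         ≡⟨ ^-distribʳ-* E b b ⟩
      b ^ E * b ^ E ≡⟨ sym (^-distribˡ-+-* b E E) ⟩
      b ^ (E + E)   ≤⟨ ^-monoʳ-≤ b (*-cancelˡ-≤ {E + E} {k * m} 2 (begin
        2 * (E + E)                       ≡⟨ expand h m n e ⟩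
        4 * h * m + 8 * (e * n)           ≤⟨ +-mono-≤ (*-monoˡ-≤ m 4h≤k) 8en≤km ⟩
        k * m + k * m                     ≡⟨ cong (k * m +_) (sym (+-identityʳ _)) ⟩
        2 * (k * m)                       ∎)) ⟩
      b ^ (k * m)   ∎
      where
      E : ℕ
      E = h * m + n * (2 * e)
      expand : ∀ h m n e → 2 * ((h * m + n * (2 * e)) + (h * m + n * (2 * e))) ≡ 4 * h * m + 8 * (e * n)
      expand = solve-∀

    -- Of the saving B^(k m) = b^(k m) b^(k m), one factor pays for the loss in `B^≤b^`. The other
    -- is 2^(6 k m) times the loss in `[2n]^k≤`, since c₁ + 8 = 6 + (c₁ + 2).
    ℓ≤ : ℓ * 2 ^ (6 * (k * m)) ≤ 2 ^ (n * n)
    ℓ≤ = *-cancelʳ-≤ _ _ X {{X≢0}} (begin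
      ℓ * 2 ^ (6 * (k * m)) * X
        ≡⟨ sym (split ℓ Q R β (2 ^ (6 * (k * m)))) ⟩
      ℓ * Q * (R * (β * (2 ^ (6 * (k * m)) * U)))
        ≡⟨ cong (λ z → ℓ * Q * (R * (β * z))) (sym b^km) ⟩
      ℓ * Q * (R * (β * β))
        ≡⟨ cong (λ z → ℓ * Q * (R * z)) (sym (trans (^-*-assoc B k m) (^-distribʳ-* (k * m) b b))) ⟩
      ℓ * Q * (R * (B ^ k) ^ m)
        ≡⟨ cong (ℓ * Q *_) (sym (^-distribʳ-* m (k !) (B ^ k))) ⟩
      ℓ * Q * (k ! * (root c₁ * root c₁) ^ k) ^ m
        ≤⟨ ℓ-bound ⟩
      2 ^ (n * n) * ((2 * n) ^ k * B ^ h) ^ m * B ^ (n * (2 * e))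
        ≤⟨ *-monoˡ-≤ (B ^ (n * (2 * e))) (*-monoʳ-≤ (2 ^ (n * n)) (^-monoˡ-≤ m (*-monoˡ-≤ (B ^ h) [2n]^k≤))) ⟩
      2 ^ (n * n) * (2 ^ (k C 2) * k ! * 2 ^ ((c₁ + 2) * k) * B ^ h) ^ m * B ^ (n * (2 * e))
        ≡⟨ cong (λ z → 2 ^ (n * n) * z * B ^ (n * (2 * e))) power ⟩
      2 ^ (n * n) * (Q * R * U * B ^ (h * m)) * B ^ (n * (2 * e))
        ≡⟨ regroup (2 ^ (n * n)) (Q * R * U) (B ^ (h * m)) (B ^ (n * (2 * e))) ⟩
      2 ^ (n * n) * (Q * R * U * (B ^ (h * m) * B ^ (n * (2 * e))))
        ≡⟨ cong (λ z → 2 ^ (n * n) * (Q * R * U * z)) (sym (^-distribˡ-+-* B (h * m) (n * (2 * e)))) ⟩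
      2 ^ (n * n) * (Q * R * U * B ^ (h * m + n * (2 * e)))
        ≤⟨ *-monoʳ-≤ (2 ^ (n * n)) (*-monoʳ-≤ (Q * R * U) B^≤b^) ⟩
      2 ^ (n * n) * (Q * R * U * β) ∎)
      where
      Q R U β X : ℕ
      Q = (2 ^ (k C 2)) ^ m
      R = (k !) ^ m
      U = 2 ^ ((c₁ + 2) * (k * m))
      β = b ^ (k * m)
      X = Q * R * U * β
      X≢0 : NonZero X
      X≢0 = m*n≢0 (Q * R * U) β {{m*n≢0 (Q * R) U {{m*n≢0 Q R {{Q≢0}} {{m^n≢0 (k !) m {{k !≢0}}}}}}
                                                  {{m^n≢0 2 ((c₁ + 2) * (k * m))}}}}
                                {{m^n≢0 b (k * m)}}
        where
        Q≢0 : NonZero Q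
        Q≢0 = m^n≢0 (2 ^ (k C 2)) m {{m^n≢0 2 (k C 2)}}
      split : ∀ ℓ q r β s {u} → ℓ * q * (r * (β * (s * u))) ≡ ℓ * s * (q * r * u * β)
      split ℓ q r β s {u} = identity ℓ q r β s u
        where
        identity : ∀ ℓ q r β s u → ℓ * q * (r * (β * (s * u))) ≡ ℓ * s * (q * r * u * β)
        identity = solve-∀
      regroup : ∀ a q x y → a * (q * x) * y ≡ a * (q * (x * y))
      regroup = solve-∀
      exponents : ∀ c x → (c + 8) * x ≡ 6 * x + (c + 2) * x
      exponents = solve-∀
      b^km : β ≡ 2 ^ (6 * (k * m)) * U
      b^km = trans (^-*-assoc 2 (c₁ + 8) (k * m))
            (trans (cong (2 ^_) (exponents c₁ (k * m))) (^-distribˡ-+-* 2 (6 * (k * m)) ((c₁ + 2) * (k * m))))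
      power : (2 ^ (k C 2) * k ! * 2 ^ ((c₁ + 2) * k) * B ^ h) ^ m ≡ Q * R * U * B ^ (h * m)
      power = trans (^-distribʳ-* m (2 ^ (k C 2) * k ! * 2 ^ ((c₁ + 2) * k)) (B ^ h))
        (cong₂ _*_
          (trans (^-distribʳ-* m (2 ^ (k C 2) * k !) (2 ^ ((c₁ + 2) * k)))
            (cong₂ _*_ (^-distribʳ-* m (2 ^ (k C 2)) (k !))
                       (trans (^-*-assoc 2 ((c₁ + 2) * k) m) (cong (2 ^_) (*-assoc (c₁ + 2) k m)))))
          (^-*-assoc B h m))

  -- N will be k m, which is at least n² / k². The exponential is then at most 2 · 16^N < 2^(6 N),
  -- because 1 + 4 N < 6 N for N ≥ 1.
  prob<exp : ∀ {n k ℓ N} .{{_ : NonZero k}} .{{_ : NonZero N}} → n * n ≤ N * (k * k) →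
    ℓ * 2 ^ (6 * N) ≤ 2 ^ (n * n) →
    LtExpNeg ((ℤ.+ ℓ ℚ./ (2 ^ (n * n))) {{m^n≢0 2 (n * n)}}) ((ℤ.+ n ℚ./ k) ℚ.* (ℤ.+ n ℚ./ k))
  prob<exp {n} {k} {ℓ} {N} nn≤ ℓ≤ = (ℤ.+ s ℚ./ 1) ,
    expPartial≤ x {{ℚ.nonNeg*nonNeg⇒nonNeg (ℤ.+ n ℚ./ k) {{/-nonNeg n k}} (ℤ.+ n ℚ./ k) {{/-nonNeg n k}}}} N x≤N ,
    subst (ℚ._< ℚ.1ℚ) (sym (/-* ℓ (2 ^ (n * n)) s 1 {{m^n≢0 2 (n * n)}}))
      (/-mono-< {ℓ * s} {2 ^ (n * n) * 1} {1} {1} {{2^nn≢0}} (small ℓ ℓ≤))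
    where
    open ≤-Reasoning
    s : ℕ
    s = 2 * 2 ^ (4 * N)
    x : ℚ.ℚ
    x = (ℤ.+ n ℚ./ k) ℚ.* (ℤ.+ n ℚ./ k)
    2^nn≢0 : NonZero (2 ^ (n * n) * 1)
    2^nn≢0 = m*n≢0 (2 ^ (n * n)) 1 {{m^n≢0 2 (n * n)}}
    kk≢0 : NonZero (k * k)
    kk≢0 = m*n≢0 k k
    x≤N : x ℚ.≤ ℤ.+ N ℚ./ 1
    x≤N = ℚ.≤-trans (ℚ.≤-reflexive (/-* n k n k))
      (/-mono {n * n} {k * k} {N} {1} {{kk≢0}} (≤-trans (≤-reflexive (*-identityʳ (n * n))) nn≤))
    s< : s < 2 ^ (6 * N)
    s< = ^-monoʳ-< 2 (s≤s (s≤s z≤n)) (begin-strict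
      1 + 4 * N ≤⟨ +-monoˡ-≤ (4 * N) (>-nonZero⁻¹ N) ⟩
      5 * N     <⟨ *-monoˡ-< N (n<1+n 5) ⟩
      6 * N     ∎)
    small : ∀ ℓ → ℓ * 2 ^ (6 * N) ≤ 2 ^ (n * n) → ℓ * s * 1 < 1 * (2 ^ (n * n) * 1)
    -- An empty list needs its own case, since multiplication by zero destroys strictness.
    small zero    _  = ≤-trans (m^n>0 2 (n * n)) (≤-reflexive (sym (trans (*-identityˡ _) (*-identityʳ _))))
    small (suc ℓ) le = begin-strict
      suc ℓ * s * 1            ≡⟨ *-identityʳ _ ⟩
      suc ℓ * s                <⟨ *-monoʳ-< (suc ℓ) s< ⟩
      suc ℓ * 2 ^ (6 * N)      ≤⟨ le ⟩
      2 ^ (n * n)              ≡⟨ sym (trans (*-identityˡ _) (*-identityʳ _)) ⟩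
      1 * (2 ^ (n * n) * 1)    ∎

  scale : ℕ → ℕ
  scale c₁ = 16 * (root c₁ * root c₁)

  -- The constant D of the theorem: the factor in `mk³≤` for B = b².
  blockDensity : ℕ → ℕ
  blockDensity c₁ = 16 * (8 * (2 * (2 * scale c₁)))

  -- C enters only through the constant c₁ in f(k) ≤ 2^(c₁ k), so both signs of C reduce to this
  -- statement.
  core : ∀ c₁ n k .{{_ : NonZero k}} → scale c₁ ≤ k → k * k ≤ n → 2 * k ≤ n →
         n C k ≤ 2 ^ (k C 2 + c₁ * k) →
         ProbLtExpNeg n (λ g → NuGt g k (blockDensity c₁)) ((ℤ.+ n ℚ./ k) ℚ.* (ℤ.+ n ℚ./ k))
  core c₁ n k τ≤k kk≤n 2k≤n nCk≤ =
    length listed ,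
    (listed , ≤-refl , covered) ,
    prob<exp {n} {k} {length listed} {k * m} {{it}} {{>-nonZero km>0}} nn≤
      (ℓ≤ c₁ n k m e h (length listed) 2k≤n 4h≤k 8en≤km nCk≤
        (≤-trans (length-tables B t e h m {{B≢0}} {{t≢0}} {{e≢0}} Bmt≤ne n≤hte m [] [] ≤-refl)
          (≤-reflexive (cong (λ z → 2 ^ (n * n) * ((2 * n) ^ k * B ^ h) ^ m * B ^ z) (sum-const n (2 * e))))))
    where
    open ≤-Reasoning
    open import Function using (it)
    b B : ℕ
    b = root c₁
    B = b * b
    instance
      b≢0 : NonZero b
      b≢0 = m^n≢0 2 (c₁ + 8)
      B≢0 : NonZero B
      B≢0 = m*n≢0 b b {{b≢0}} {{b≢0}}
    open Parameters (parameters B n k {{B≢0}} τ≤k kk≤n)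
    listed : List (Table n)
    listed = tables k m []
    n>0 : n > 0
    n>0 = ≤-trans (>-nonZero⁻¹ k) (≤-trans (m≤m*n k k) kk≤n)
    km>0 : k * m > 0
    km>0 = ≤-trans (≤-trans (≤-trans n>0 (m≤n*m n e {{e≢0}})) (m≤n*m (e * n) 8)) 8en≤km
    nn≤ : n * n ≤ k * m * (k * k)
    nn≤ = begin
      n * n                 ≤⟨ *-monoˡ-≤ n n≤hte ⟩
      h * (t * e) * n       ≤⟨ *-monoˡ-≤ n (*-mono-≤ (≤-trans (m≤n*m h 4) 4h≤k) (*-monoˡ-≤ e t≤k)) ⟩
      k * (k * e) * n       ≡⟨ regroup k e n ⟩
      e * n * (k * k)       ≤⟨ *-monoˡ-≤ (k * k) (≤-trans (m≤n*m (e * n) 8) 8en≤km) ⟩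
      k * m * (k * k)       ∎
      where
      regroup : ∀ k e n → k * (k * e) * n ≡ e * n * (k * k)
      regroup = solve-∀
    -- A family above the density bound has at least m members, and its first m already place g on
    -- the list.
    covered : ∀ g → NuGt g k (blockDensity c₁) → g LM.∈ tables k m []
    covered g (M , M-large , 𝓕 , cliques , disjoint) =
      ∈-tables g k m [] (λ i j req → contradiction req (none i j)) (𝓕 ∘ inject) (cliques ∘ inject)
        (λ _ _ _ _ _ → refl)
        (λ a b a≢b → proj₂ (disjoint (inject a) (inject b) (a≢b ∘ inject≤-injective m≤M m≤M a b)))
      where
      m≤M : m ≤ M
      m≤M = <⇒≤ (*-cancelʳ-< (k ^ 3) m M (≤-<-trans mk³≤ M-large))
      inject : Fin m → Fin M
      inject a = inject≤ a m≤M
      none : ∀ i j → required {n} [] i j ≢ true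
      none i j eq with toℕ i <ᵇ toℕ j
      none i j () | true
      none i j () | false

  -- Bounds on f(k) near k₀ and the two signs of C

  kC2≤[k+c]C2 : ∀ k c → k C 2 ≤ (k + c) C 2
  kC2≤[k+c]C2 k zero    = ≤-reflexive (cong (_C 2) (sym (+-identityʳ k)))
  kC2≤[k+c]C2 k (suc c) = begin
    k C 2                     ≤⟨ kC2≤[k+c]C2 k c ⟩
    (k + c) C 2               ≤⟨ m≤n+m _ ((k + c) C 1) ⟩
    (k + c) C 1 + (k + c) C 2 ≡⟨ nCk+nC[k+1]≡[n+1]C[k+1] (k + c) 1 ⟩
    suc (k + c) C 2           ≡⟨ cong (_C 2) (sym (+-suc k c)) ⟩
    (k + suc c) C 2           ∎
    where open ≤-Reasoning

  -- Binomial coefficients increase up to n / 2, so the estimate at k₀ carries over to k. The price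
  -- is the excess of C(k₀, 2) over C(k, 2), which is linear in k.
  nCk≤-below : ∀ {n k c} .{{_ : NonZero k}} → IsK0 n (k + c) → 2 * (k + c) ≤ n → n C k ≤ 2 ^ (k C 2 + (c + c * c) * k)
  nCk≤-below {n} {k} {c} (_ , f<1 , _) 2k₀≤n = begin
    n C k                               ≤⟨ C-increasing n k c 2k₀≤n ⟩
    n C (k + c)                         ≤⟨ <⇒≤ f<1 ⟩
    2 ^ ((k + c) C 2)                   ≤⟨ ^-monoʳ-≤ 2 ([k+c]C2≤ k c) ⟩
    2 ^ (k C 2 + (c + c * c) * k)       ∎
    where open ≤-Reasoning

  -- Each of the c vertices beyond k₀ multiplies the binomial coefficient by at most n ≤ 2^(3 k₀), a
  -- loss that is still only exponential in k.
  nCk≤-above : ∀ {n k₀} c → IsK0 n k₀ → 2 * k₀ ≤ n → n C (k₀ + c) ≤ 2 ^ ((k₀ + c) C 2 + 3 * c * (k₀ + c))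
  nCk≤-above {n} {k₀} c k₀-min@(_ , f<1 , _) 2k₀≤n = begin
    n C (k₀ + c)                                ≤⟨ nC[k+c]≤n^c*nCk n k₀ c ⟩
    n ^ c * (n C k₀)                            ≤⟨ *-mono-≤ (^-monoˡ-≤ c (n≤2^3k₀ k₀-min 2k₀≤n)) (<⇒≤ f<1) ⟩
    (2 ^ (3 * k₀)) ^ c * 2 ^ (k₀ C 2)           ≡⟨ cong (_* 2 ^ (k₀ C 2)) (^-*-assoc 2 (3 * k₀) c) ⟩
    2 ^ (3 * k₀ * c) * 2 ^ (k₀ C 2)             ≡⟨ sym (^-distribˡ-+-* 2 (3 * k₀ * c) (k₀ C 2)) ⟩
    2 ^ (3 * k₀ * c + k₀ C 2)                   ≤⟨ ^-monoʳ-≤ 2 exponent ⟩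
    2 ^ ((k₀ + c) C 2 + 3 * c * (k₀ + c))       ∎
    where
    open ≤-Reasoning
    swap : ∀ a c → 3 * a * c ≡ 3 * c * a
    swap = solve-∀
    exponent : 3 * k₀ * c + k₀ C 2 ≤ (k₀ + c) C 2 + 3 * c * (k₀ + c)
    exponent = begin
      3 * k₀ * c + k₀ C 2                 ≤⟨ +-mono-≤ (≤-trans (≤-reflexive (swap k₀ c)) (*-monoʳ-≤ (3 * c) (m≤m+n k₀ c)))
                                                      (kC2≤[k+c]C2 k₀ c) ⟩
      3 * c * (k₀ + c) + (k₀ + c) C 2     ≡⟨ +-comm _ ((k₀ + c) C 2) ⟩
      (k₀ + c) C 2 + 3 * c * (k₀ + c)     ∎

  -- scale c₁ is what the density argument needs, 26 what 4k₀²≤n needs.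
  threshold : ℕ → ℕ → ℕ
  threshold c₁ c = scale c₁ + c + 26

  start : ℕ → ℕ
  start K = 2 ^ (K * K) + 2 * K

  module _ {n k₀ : ℕ} (k₀-min : IsK0 n k₀) (c₁ c : ℕ) (start≤n : start (threshold c₁ c) ≤ n) where
    open ≤-Reasoning

    K≤k₀ : threshold c₁ c ≤ k₀
    K≤k₀ = k₀-large (threshold c₁ c) k₀-min start≤n

    scale+c≤k₀ : scale c₁ + c ≤ k₀
    scale+c≤k₀ = m+n≤o⇒m≤o (scale c₁ + c) K≤k₀

    -- For k = k₀ + c this gives k ≤ 2 k₀, the range that `4k₀²≤n` provides for.
    c≤k₀ : c ≤ k₀
    c≤k₀ = m+n≤o⇒n≤o (scale c₁) scale+c≤k₀

    k*k≤n : ∀ {k} → k ≤ 2 * k₀ → k * k ≤ n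
    k*k≤n {k} k≤2k₀ = begin
      k * k               ≤⟨ *-mono-≤ k≤2k₀ k≤2k₀ ⟩
      2 * k₀ * (2 * k₀)   ≡⟨ square k₀ ⟩
      4 * (k₀ * k₀)       ≤⟨ 4k₀²≤n k₀-min (m+n≤o⇒n≤o (scale c₁ + c) K≤k₀) ⟩
      n                   ∎
      where
      square : ∀ x → 2 * x * (2 * x) ≡ 4 * (x * x)
      square = solve-∀

    2*k≤n : ∀ {k} → scale c₁ ≤ k → k ≤ 2 * k₀ → 2 * k ≤ n
    2*k≤n {k} scale≤k k≤2k₀ = ≤-trans (*-monoˡ-≤ k (≤-trans 2≤scale scale≤k)) (k*k≤n k≤2k₀)
      where
      2≤scale : 2 ≤ scale c₁
      2≤scale = ≤-trans (m≤m+n 2 14) (m≤m*n 16 (root c₁ * root c₁)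
                  {{m*n≢0 (root c₁) (root c₁) {{m^n≢0 2 (c₁ + 8)}} {{m^n≢0 2 (c₁ + 8)}}}})

  -- The relation between k and k₀ is a parameter, so that each sign of C can be expressed by an
  -- addition of natural numbers.
  TailBound : (ℕ → ℕ → Set) → Set
  TailBound Related = ∃ λ D → ∃ λ N →
    ∀ n → N ≤ n → ∀ k₀ → IsK0 n k₀ → ∀ k .{{_ : NonZero k}} → Related k k₀ →
    ProbLtExpNeg n (λ g → NuGt g k D) ((ℤ.+ n ℚ./ k) ℚ.* (ℤ.+ n ℚ./ k))

  tailBound-below : ∀ c → TailBound (λ k k₀ → k + c ≡ k₀)
  tailBound-below c = blockDensity c₁ , start (threshold c₁ c) , bound
    where
    c₁ : ℕ
    c₁ = c + c * c
    bound : ∀ n → start (threshold c₁ c) ≤ n → ∀ k₀ → IsK0 n k₀ → ∀ k .{{_ : NonZero k}} → k + c ≡ k₀ →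
            ProbLtExpNeg n (λ g → NuGt g k (blockDensity c₁)) ((ℤ.+ n ℚ./ k) ℚ.* (ℤ.+ n ℚ./ k))
    bound n start≤n _ k₀-min k refl =
      core c₁ n k scale≤k (k*k≤n k₀-min c₁ c start≤n k≤2k₀) (2*k≤n k₀-min c₁ c start≤n scale≤k k≤2k₀)
        (nCk≤-below k₀-min (2*k≤n k₀-min c₁ c start≤n (≤-trans scale≤k (m≤m+n k c)) (m≤n*m (k + c) 2)))
      where
      scale≤k : scale c₁ ≤ k
      scale≤k = +-cancelʳ-≤ c _ _ (scale+c≤k₀ k₀-min c₁ c start≤n)
      k≤2k₀ : k ≤ 2 * (k + c)
      k≤2k₀ = ≤-trans (m≤m+n k c) (m≤n*m (k + c) 2)

  tailBound-above : ∀ c → TailBound (λ k k₀ → k ≡ k₀ + c)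
  tailBound-above c = blockDensity c₁ , start (threshold c₁ c) , bound
    where
    c₁ : ℕ
    c₁ = 3 * c
    bound : ∀ n → start (threshold c₁ c) ≤ n → ∀ k₀ → IsK0 n k₀ → ∀ k .{{_ : NonZero k}} → k ≡ k₀ + c →
            ProbLtExpNeg n (λ g → NuGt g k (blockDensity c₁)) ((ℤ.+ n ℚ./ k) ℚ.* (ℤ.+ n ℚ./ k))
    bound n start≤n k₀ k₀-min k refl =
      core c₁ n k scale≤k (k*k≤n k₀-min c₁ c start≤n k≤2k₀) (2*k≤n k₀-min c₁ c start≤n scale≤k k≤2k₀)
        (nCk≤-above c k₀-min (2*k≤n k₀-min c₁ c start≤n scale≤k₀ (m≤n*m k₀ 2)))
      where
      scale≤k₀ : scale c₁ ≤ k₀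
      scale≤k₀ = m+n≤o⇒m≤o (scale c₁) (scale+c≤k₀ k₀-min c₁ c start≤n)
      scale≤k : scale c₁ ≤ k
      scale≤k = ≤-trans scale≤k₀ (m≤m+n k₀ c)
      k≤2k₀ : k ≤ 2 * k₀
      k≤2k₀ = +-monoʳ-≤ k₀ (≤-trans (c≤k₀ k₀-min c₁ c start≤n) (m≤m+n k₀ 0))

  k+c≡k₀ : ∀ {k k₀ c} → ℤ.+ k ≡ ℤ.+ k₀ ℤ.- ℤ.+ c → k + c ≡ k₀
  k+c≡k₀ {k} {k₀} {c} k≡ = ℤ.+-injective (begin
    ℤ.+ k ℤ.+ ℤ.+ c                     ≡⟨ cong (λ z → z ℤ.+ ℤ.+ c) k≡ ⟩
    ℤ.+ k₀ ℤ.- ℤ.+ c ℤ.+ ℤ.+ c          ≡⟨ ℤ.+-assoc (ℤ.+ k₀) (ℤ.- ℤ.+ c) (ℤ.+ c) ⟩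
    ℤ.+ k₀ ℤ.+ (ℤ.- ℤ.+ c ℤ.+ ℤ.+ c)    ≡⟨ cong (λ z → ℤ.+ k₀ ℤ.+ z) (ℤ.+-inverseˡ (ℤ.+ c)) ⟩
    ℤ.+ k₀ ℤ.+ ℤ.+ 0                    ≡⟨ ℤ.+-identityʳ (ℤ.+ k₀) ⟩
    ℤ.+ k₀                              ∎)
    where open ≡-Reasoning

open TailBounds using (tailBound-below; tailBound-above; k+c≡k₀)
open import Data.Integer.Properties using (+-injective)
open import Data.Nat using (ℕ; _≤_; NonZero; suc)
open import Data.Integer using (ℤ; +_; -[1+_]; _-_)
open import Data.Rational using (_/_; _*_)
open import Data.Product using (∃; _,_)
open import Relation.Binary.PropositionalEquality using (_≡_)

theorem1p2 : ∀ (C : ℤ) → ∃ λ (D : ℕ) → ∃ λ (N : ℕ) →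
    ∀ (n : ℕ) → N ≤ n → ∀ (k0 : ℕ) → IsK0 n k0 →
    ∀ (k : ℕ) .{{_ : NonZero k}} → + k ≡ + k0 - C →
    ProbLtExpNeg n (λ g → NuGt g k D) ((+ n / k) * (+ n / k))
theorem1p2 (+ c) with D , N , bound ← tailBound-below c =
  D , N , λ n N≤n k0 k0-min k k≡ → bound n N≤n k0 k0-min k (k+c≡k₀ k≡)
-- Here C = -(c + 1), and k₀ - C computes to k₀ + (c + 1).
theorem1p2 -[1+ c ] with D , N , bound ← tailBound-above (suc c) =
  D , N , λ n N≤n k0 k0-min k k≡ → bound n N≤n k0 k0-min k (+-injective k≡)
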